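{- Let $p,q$ be integers with $5 \le p \le q$, and let $K(3,p,q)$ be the complete tripartite graph with parts of sizes $3$, $p$, $q$. Then $$f(K(3,p,q)) = \begin{cases} 2, & \text{if } p \le q < \binom{p+1}{\lfloor \frac{p+1}{2} \rfloor};\\ 3, & \text{if } q \ge \binom{p+1}{\lfloor \frac{p+1}{2} \rfloor}.\end{cases}$$
   Context: For a bridgeless connected graph $G$, a strong orientation of $G$ is an assignment of a direction to each edge such that the resulting digraph is strongly connected. The diameter $\mathrm{diam}(D)$ of a strongly connected digraph $D$ is the maximum over ordered pairs of vertices $(u,v)$ of the length of a shortest directed path from $u$ to $v$. The oriented diameter of $G$ is $f(G)=\min\{\mathrm{diam}(D) : D \text{ a strong orientation of } G\}$. -}

module Defs where

open import Data.Nat using (ℕ; zero; suc; _+_; _≤_; _<_; _<?_)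
open import Data.Fin using (Fin; toℕ)
open import Data.Bool using (Bool; true; false)
open import Data.Product using (Σ; _×_; _,_; ∃)
open import Data.Sum using (_⊎_)
open import Relation.Nullary using (¬_; yes; no)
open import Relation.Binary.PropositionalEquality using (_≡_)

Graph : ℕ → Set₁
Graph n = Fin n → Fin n → Set

Digraph : ℕ → Set
Digraph n = Fin n → Fin n → Bool

IsOrientation : ∀ {n} → Graph n → Digraph n → Set
IsOrientation {n} G D =
  (∀ (u v : Fin n) → D u v ≡ true → G u v) ×
  (∀ (u v : Fin n) → G u v → (D u v ≡ true ⊎ D v u ≡ true)) ×
  (∀ (u v : Fin n) → D u v ≡ true → D v u ≡ false)

data Walk {n} (D : Digraph n) : ℕ → Fin n → Fin n → Set where
  here : ∀ {u} → Walk D zero u u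
  step : ∀ {k u v w} → D u v ≡ true → Walk D k v w → Walk D (suc k) u w

DistLe : ∀ {n} → Digraph n → Fin n → Fin n → ℕ → Set
DistLe D u v k = Σ ℕ λ l → l ≤ k × Walk D l u v

StronglyConnected : ∀ {n} → Digraph n → Set
StronglyConnected {n} D = ∀ (u v : Fin n) → Σ ℕ λ l → Walk D l u v

HasDiam : ∀ {n} → Digraph n → ℕ → Set
HasDiam {n} D d =
  (∀ (u v : Fin n) → DistLe D u v d) ×
  (Σ (Fin n) λ u → Σ (Fin n) λ v → ∀ (l : ℕ) → l < d → ¬ Walk D l u v)

StrongOrientation : ∀ {n} → Graph n → Digraph n → Set
StrongOrientation G D = IsOrientation G D × StronglyConnected D

OrientedDiam : ∀ {n} → Graph n → ℕ → Set
OrientedDiam {n} G d =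
  (Σ (Digraph n) λ D → StrongOrientation G D × HasDiam D d) ×
  (∀ (D : Digraph n) (d' : ℕ) → StrongOrientation G D → HasDiam D d' → d ≤ d')

part : (a b c : ℕ) → Fin (a + b + c) → ℕ
part a b c u with toℕ u <? a
... | yes _ = 0
... | no _ with toℕ u <? a + b
...   | yes _ = 1
...   | no _ = 2

K3 : (a b c : ℕ) → Graph (a + b + c)
K3 a b c u v = ¬ (part a b c u ≡ part a b c v)

{-# OPTIONS --safe #-}
-- Let X, Y, Z be the parts of sizes 3, p, q. In an orientation of diameter 2 the out-neighbourhoods of the vertices of Z
-- form an antichain. Sort these vertices z by their out-neighbourhood S z in X. Within a class, the distances between
-- z and y ∈ Y fix the direction of the edge zy as soon as S z and the out-neighbourhood N y of y in X are comparable;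
-- so the class is an antichain on the remaining vertices y, and Sperner's theorem bounds it. Whether the sum of the
-- class bounds is below s = C(p+1, ⌊(p+1)/2⌋) depends only on how often, up to 2, each subset of X occurs as an N y,
-- and a finite check confirms it, except when all N y contain some k and avoid some i. Then all S z contain i and
-- avoid k, so the z form an antichain in a cube of dimension p + 1. The distances between z and the third vertex of X
-- make it avoid one longest chain, and a partition into s chains that includes this one gives q < s.
--
-- Conversely, q distinct ⌊(p+1)/2⌋-subsets of a (p+1)-set other than an initial segment, among them all other cyclic
-- intervals, give an orientation of diameter 2; the blow-up of a directed triangle always has diameter 3.
module Submission where

open import Defs
open import Data.Bool using (Bool; true; false; not; _∧_; _∨_; if_then_else_; T; f≤t; b≤b) renaming (_≤_ to _≤ᵇ_; _≟_ to _≟ᵇ_)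
open import Data.Empty using (⊥; ⊥-elim)
open import Data.Fin using (Fin; zero; suc; toℕ; fromℕ<; inject≤; splitAt; _↑ˡ_; _↑ʳ_)
open import Data.Fin.Properties using (injective⇒≤; inject≤-injective; ↑ˡ-injective; ↑ʳ-injective; splitAt-↑ˡ; splitAt-↑ʳ; toℕ-injective; toℕ<n; toℕ-fromℕ<; toℕ-↑ˡ; toℕ-↑ʳ; join-splitAt) renaming (_≟_ to _≟ᶠ_)
open import Data.List using (List; []; _∷_; _++_; map; length; allFin; lookup; replicate; applyUpTo)
open import Data.List.Membership.Propositional using (_∈_; _∉_; find; lose)
open import Data.List.Membership.Propositional.Properties using (∈-map⁺; ∈-map⁻; ∈-++⁺ˡ; ∈-++⁺ʳ; ∈-++⁻; ∈-allFin; ∈-lookup; ∈-applyUpTo⁺; ∈-applyUpTo⁻)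
open import Data.List.Properties using (length-tabulate; length-map; length-++; length-applyUpTo; ∷-injectiveʳ; ≡-dec)
open import Data.List.Membership.DecPropositional (≡-dec _≟ᵇ_) using (_∈?_)
open import Data.List.Relation.Binary.Pointwise using (Pointwise; []; _∷_)
open import Data.List.Relation.Unary.All using (All; []; _∷_)
import Data.List.Relation.Unary.All as All
open import Data.List.Relation.Unary.All.Properties using (++⁻ʳ)
open import Data.List.Relation.Unary.AllPairs using ([]; _∷_)
open import Data.List.Relation.Unary.Any using (Any; here; there; index; any?)
open import Data.List.Relation.Unary.Any.Properties using (lookup-index)
open import Data.List.Relation.Unary.Unique.Propositional using (Unique)
open import Data.List.Relation.Unary.Unique.Propositional.Properties using () renaming (map⁺ to unique-map⁺; ++⁺ to unique-++⁺)
open import Data.Nat using (ℕ; zero; suc; _+_; _*_; _∸_; _≤_; _<_; _/_; z≤n; s≤s; ⌈_/2⌉; ⌊_/2⌋; _≤?_; _<?_; _⊓_; _≤′_; ≤′-refl; ≤′-step; _≡ᵇ_) renaming (_≤ᵇ_ to _≤ℕᵇ_; _≟_ to _≟ℕ_)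
open import Data.Nat.Combinatorics using (_C_; nCk+nC[k+1]≡[n+1]C[k+1]; nCk≡nC[n∸k])
open import Data.Nat.DivMod using (+-distrib-/-∣ˡ)
open import Data.Nat.Divisibility using (∣-refl)
open import Data.Nat.ListAction using (sum)
open import Data.Nat.Properties
open import Data.Nat.Solver using (module +-*-Solver)
open import Data.Product using (Σ; _×_; _,_; ∃; proj₁; proj₂)
open import Data.Sum using (_⊎_; inj₁; inj₂; [_,_]′; swap)
open import Data.Unit using (⊤; tt)
open import Data.Vec using (Vec; []; _∷_)
import Data.Vec.Relation.Unary.All as VAll
open VAll using ([]; _∷_)
open import Function using (_∘_; id)
open import Relation.Binary.Definitions using (tri<; tri≈; tri>)
open import Relation.Binary.PropositionalEquality using (_≡_; _≢_; refl; sym; trans; cong; cong₂; subst; subst₂; module ≡-Reasoning)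
open import Relation.Nullary using (¬_; yes; no; does)
open import Relation.Nullary.Decidable using (¬?; decidable-stable; dec-true; dec-false)

-- Chains of the Boolean lattice and ballot paths

-- Reading a 0/1 word from the left, every `true` is matched with the latest unmatched `false`; the code of the
-- word records by `false` the matched `true`s. The words with a given code form a symmetric chain.
-- Here i and d are the numbers of unmatched `true`s and `false`s read so far.
code : List Bool → ℕ → ℕ → List Bool
code []          i d       = []
code (false ∷ v) i d       = true ∷ code v i (suc d)
code (true ∷ v)  i zero    = true ∷ code v (suc i) zero
code (true ∷ v)  i (suc d) = false ∷ code v i d

unmatched : List Bool → ℕ → ℕ → ℕ
unmatched []          i d       = i
unmatched (false ∷ v) i d       = unmatched v i (suc d)
unmatched (true ∷ v)  i zero    = unmatched v (suc i) zero
unmatched (true ∷ v)  i (suc d) = unmatched v i d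

-- Paths with steps ±1 on the nonnegative integers, of length n and starting at height j; `true` is
-- a step up.
ballots : ℕ → ℕ → List (List Bool)
ballots zero    j       = [] ∷ []
ballots (suc n) zero    = map (true ∷_) (ballots n 1)
ballots (suc n) (suc j) = map (true ∷_) (ballots n (suc (suc j))) ++ map (false ∷_) (ballots n j)

-- The height of the path is the number d + i of unmatched letters: a `true` that closes a match
-- lowers it by one, every other letter raises it by one.
code∈ballots : ∀ v i d → code v i d ∈ ballots (length v) (d + i)
code∈ballots []          i d = here refl
code∈ballots (false ∷ v) i zero = up i (code∈ballots v i 1)
  where
  up : ∀ {n p} j → p ∈ ballots n (suc j) → (true ∷ p) ∈ ballots (suc n) j
  up zero    m = ∈-map⁺ (true ∷_) m
  up (suc j) m = ∈-++⁺ˡ (∈-map⁺ (true ∷_) m)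
code∈ballots (false ∷ v) i (suc d) = ∈-++⁺ˡ (∈-map⁺ (true ∷_) (code∈ballots v i (suc (suc d))))
code∈ballots (true ∷ v)  zero    zero    = ∈-map⁺ (true ∷_) (code∈ballots v 1 zero)
code∈ballots (true ∷ v)  (suc i) zero    = ∈-++⁺ˡ (∈-map⁺ (true ∷_) (code∈ballots v (suc (suc i)) zero))
code∈ballots (true ∷ v)  i       (suc d) = ∈-++⁺ʳ _ (∈-map⁺ (false ∷_) (code∈ballots v i d))

-- Words with the same code agree at the matched positions, and their unmatched letters read true
-- ... true false ... false, so the number of unmatched `true`s orders them. The inequality i ≤ i'
-- is carried back from the ends of the words; it excludes an unmatched `true` of v opposite a
-- `false` of w.
code-comparable : ∀ v w i d i' d' → d + i ≡ d' + i' → code v i d ≡ code w i' d' →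
  unmatched v i d ≤ unmatched w i' d' → i ≤ i' × Pointwise _≤ᵇ_ v w
code-comparable [] [] i d i' d' h e u = u , []
code-comparable [] (false ∷ w) i d i' d' h () u
code-comparable [] (true ∷ w) i d i' zero h () u
code-comparable [] (true ∷ w) i d i' (suc d') h () u
code-comparable (false ∷ v) [] i d i' d' h () u
code-comparable (true ∷ v) [] i zero i' d' h () u
code-comparable (true ∷ v) [] i (suc d) i' d' h () u
code-comparable (false ∷ v) (false ∷ w) i d i' d' h e u
  with code-comparable v w i (suc d) i' (suc d') (cong suc h) (∷-injectiveʳ e) u
... | le , pw = le , b≤b ∷ pw
code-comparable (false ∷ v) (true ∷ w) i d i' zero h e u
  with code-comparable v w i (suc d) (suc i') zero (cong suc h) (∷-injectiveʳ e) u
... | le , pw = subst (i ≤_) h (m≤n+m i d) , f≤t ∷ pw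
code-comparable (false ∷ v) (true ∷ w) i d i' (suc d') h () u
code-comparable (true ∷ v) (false ∷ w) i zero i' d' h e u
  with code-comparable v w (suc i) zero i' (suc d') (cong suc h) (∷-injectiveʳ e) u
... | le , pw = ⊥-elim (1+n≰n (≤-trans le (subst (i' ≤_) (sym h) (m≤n+m i' d'))))
code-comparable (true ∷ v) (false ∷ w) i (suc d) i' d' h () u
code-comparable (true ∷ v) (true ∷ w) i zero i' zero h e u
  with code-comparable v w (suc i) zero (suc i') zero (cong suc h) (∷-injectiveʳ e) u
... | s≤s le , pw = le , b≤b ∷ pw
code-comparable (true ∷ v) (true ∷ w) i zero i' (suc d') h () u
code-comparable (true ∷ v) (true ∷ w) i (suc d) i' zero h () u
code-comparable (true ∷ v) (true ∷ w) i (suc d) i' (suc d') h e u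
  with code-comparable v w i d i' d' (suc-injective h) (∷-injectiveʳ e) u
... | le , pw = le , b≤b ∷ pw

same-code⇒comparable : ∀ v w → code v 0 0 ≡ code w 0 0 → Pointwise _≤ᵇ_ v w ⊎ Pointwise _≤ᵇ_ w v
same-code⇒comparable v w e with ≤-total (unmatched v 0 0) (unmatched w 0 0)
... | inj₁ u = inj₁ (proj₂ (code-comparable v w 0 0 0 0 refl e u))
... | inj₂ u = inj₂ (proj₂ (code-comparable w v 0 0 0 0 refl (sym e) u))

map-≤-lookup : ∀ {A : Set} {f g : A → Bool} {xs x} → Pointwise _≤ᵇ_ (map f xs) (map g xs) → x ∈ xs → f x ≤ᵇ g x
map-≤-lookup (r ∷ rs) (here refl) = r
map-≤-lookup (r ∷ rs) (there m)   = map-≤-lookup rs m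

-- The number of walks of length n from j to 0 on ℕ with a loop at 0.
r : ℕ → ℕ → ℕ
r zero    zero    = 1
r zero    (suc j) = 0
r (suc n) zero    = r n 0 + r n 1
r (suc n) (suc j) = r n j + r n (suc (suc j))

partialSum : (ℕ → ℕ) → ℕ → ℕ
partialSum f zero    = f 0
partialSum f (suc j) = partialSum f j + f (suc j)

-- This is the recursion of `ballots`, so the partial sums of `r` count its paths.
partialSum-r : ∀ n j → partialSum (r (suc n)) (suc j) ≡ partialSum (r n) (suc (suc j)) + partialSum (r n) j
partialSum-r n zero = solve 3 (λ a b c → (a :+ b) :+ (a :+ c) := ((a :+ b) :+ c) :+ a) refl (r n 0) (r n 1) (r n 2)
  where open +-*-Solver
partialSum-r n (suc j) rewrite partialSum-r n j =
  solve 4 (λ a b c d → (a :+ b) :+ (c :+ d) := (a :+ d) :+ (b :+ c)) refl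
    (partialSum (r n) (suc (suc j))) (partialSum (r n) j) (r n (suc j)) (r n (suc (suc (suc j))))
  where open +-*-Solver

length-ballots : ∀ n j → length (ballots n j) ≡ partialSum (r n) j
length-ballots zero zero = refl
length-ballots zero (suc j) = trans (length-ballots zero j) (sym (+-identityʳ _))
length-ballots (suc n) zero = trans (length-map _ (ballots n 1)) (length-ballots n 1)
length-ballots (suc n) (suc j) = begin
  length (map (true ∷_) (ballots n (suc (suc j))) ++ map (false ∷_) (ballots n j))
    ≡⟨ length-++ (map (true ∷_) (ballots n (suc (suc j)))) ⟩
  length (map (true ∷_) (ballots n (suc (suc j)))) + length (map (false ∷_) (ballots n j))
    ≡⟨ cong₂ _+_ (length-map _ (ballots n (suc (suc j)))) (length-map _ (ballots n j)) ⟩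
  length (ballots n (suc (suc j))) + length (ballots n j)
    ≡⟨ cong₂ _+_ (length-ballots n (suc (suc j))) (length-ballots n j) ⟩
  partialSum (r n) (suc (suc j)) + partialSum (r n) j
    ≡⟨ partialSum-r n j ⟨
  partialSum (r (suc n)) (suc j) ∎
  where open ≡-Reasoning

-- For j > 0 the recursion of `r` is Pascal's rule. At 0 the loop contributes the term n C ⌈ n /2⌉,
-- which has to be turned into n C ⌊ n /2⌋ by symmetry.
r≡C : ∀ n j → r n j ≡ n C ⌈ n + j /2⌉
r≡C zero zero = refl
r≡C zero (suc j) = refl
r≡C (suc n) zero = begin
  r n 0 + r n 1                          ≡⟨ cong₂ _+_ (r≡C n 0) (r≡C n 1) ⟩
  n C ⌈ n + 0 /2⌉ + n C ⌈ n + 1 /2⌉      ≡⟨ cong₂ (λ a b → n C ⌈ a /2⌉ + n C ⌈ b /2⌉) (+-identityʳ n) (+-comm n 1) ⟩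
  n C ⌈ n /2⌉ + n C suc ⌊ n /2⌋          ≡⟨ cong (_+ n C suc ⌊ n /2⌋) half ⟩
  n C ⌊ n /2⌋ + n C suc ⌊ n /2⌋          ≡⟨ nCk+nC[k+1]≡[n+1]C[k+1] n ⌊ n /2⌋ ⟩
  suc n C ⌈ suc n /2⌉                    ≡⟨ cong (λ a → suc n C ⌈ suc a /2⌉) (+-identityʳ n) ⟨
  suc n C ⌈ suc n + 0 /2⌉                ∎
  where
  open ≡-Reasoning
  half : n C ⌈ n /2⌉ ≡ n C ⌊ n /2⌋
  half = trans (nCk≡nC[n∸k] (⌈n/2⌉≤n n)) (cong (n C_) (trans (cong (_∸ ⌈ n /2⌉) (sym (⌊n/2⌋+⌈n/2⌉≡n n))) (m+n∸n≡m ⌊ n /2⌋ ⌈ n /2⌉)))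
r≡C (suc n) (suc j) = begin
  r n j + r n (suc (suc j))                        ≡⟨ cong₂ _+_ (r≡C n j) (r≡C n (suc (suc j))) ⟩
  n C ⌈ n + j /2⌉ + n C ⌈ n + suc (suc j) /2⌉      ≡⟨ cong (λ a → n C ⌈ n + j /2⌉ + n C ⌈ a /2⌉) (trans (+-suc n (suc j)) (cong suc (+-suc n j))) ⟩
  n C ⌈ n + j /2⌉ + n C suc ⌈ n + j /2⌉            ≡⟨ nCk+nC[k+1]≡[n+1]C[k+1] n ⌈ n + j /2⌉ ⟩
  suc n C suc ⌈ n + j /2⌉                          ≡⟨ cong (λ a → suc n C ⌈ suc a /2⌉) (+-suc n j) ⟨
  suc n C ⌈ suc n + suc j /2⌉                      ∎
  where open ≡-Reasoning

-- The central binomial coefficient, by `s≡central`, and the number of codes of words of length n.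
s : ℕ → ℕ
s n = r n 0

n/2≡⌊n/2⌋ : ∀ n → n / 2 ≡ ⌊ n /2⌋
n/2≡⌊n/2⌋ zero = refl
n/2≡⌊n/2⌋ (suc zero) = refl
n/2≡⌊n/2⌋ (suc (suc n)) = trans (+-distrib-/-∣ˡ {2} n ∣-refl) (cong suc (n/2≡⌊n/2⌋ n))

s≡central : ∀ n → n C (n / 2) ≡ s n
s≡central n = begin
  n C (n / 2)          ≡⟨ cong (n C_) (n/2≡⌊n/2⌋ n) ⟩
  n C ⌊ n /2⌋          ≡⟨ nCk≡nC[n∸k] (⌊n/2⌋≤n n) ⟩
  n C (n ∸ ⌊ n /2⌋)    ≡⟨ cong (λ a → n C (a ∸ ⌊ n /2⌋)) (⌊n/2⌋+⌈n/2⌉≡n n) ⟨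
  n C (⌊ n /2⌋ + ⌈ n /2⌉ ∸ ⌊ n /2⌋) ≡⟨ cong (n C_) (m+n∸m≡n ⌊ n /2⌋ ⌈ n /2⌉) ⟩
  n C ⌈ n /2⌉          ≡⟨ cong (λ a → n C ⌈ a /2⌉) (+-identityʳ n) ⟨
  n C ⌈ n + 0 /2⌉      ≡⟨ r≡C n 0 ⟨
  s n                  ∎
  where open ≡-Reasoning

length-ballots₀ : ∀ n → length (ballots n 0) ≡ s n
length-ballots₀ n = length-ballots n 0

-- Orientations of diameter 2

-- A subset of X. Triples of bits, unlike functions, can be compared and enumerated by computation.
Ty : Set
Ty = Bool × Bool × Bool

at : Ty → Fin 3 → Bool
at (a , b , c) zero             = a
at (a , b , c) (suc zero)       = b
at (a , b , c) (suc (suc zero)) = c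

_⊆_ : Ty → Ty → Set
S ⊆ S' = ∀ x → at S x ≤ᵇ at S' x

-- The part of the diameter 2 condition that involves the third part, for vertices x : Fin 3, y : Fin p, z : Fin q:
-- `at (N y) x`, `at (S z) x` and `B z y` say that the edges are directed y → x, z → x and z → y.
record Config (p q : ℕ) : Set where
  field
    N  : Fin p → Ty
    S  : Fin q → Ty
    B  : Fin q → Fin p → Bool
    zz : ∀ z z' → S z ⊆ S z' → (∀ y → B z y ≤ᵇ B z' y) → z ≡ z'
    zy : ∀ z y → S z ⊆ N y → B z y ≡ true
    yz : ∀ z y → N y ⊆ S z → B z y ≡ false
    zx : ∀ z x → at (S z) x ≡ false → ∃ λ y → B z y ≡ true × at (N y) x ≡ true
    xz : ∀ z x → at (S z) x ≡ true → ∃ λ y → B z y ≡ false × at (N y) x ≡ false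

all₃ any₃ : (Fin 3 → Bool) → Bool
all₃ f = f zero ∧ f (suc zero) ∧ f (suc (suc zero))
any₃ f = f zero ∨ f (suc zero) ∨ f (suc (suc zero))

∨-true : ∀ a b → a ∨ b ≡ true → a ≡ true ⊎ b ≡ true
∨-true true  b e = inj₁ refl
∨-true false b e = inj₂ e

∧-true : ∀ a b → a ∧ b ≡ true → a ≡ true × b ≡ true
∧-true true b e = refl , e

not-true : ∀ {a} → not a ≡ true → a ≡ false
not-true {false} e = refl

true≢false : ∀ {a} → a ≡ true → a ≡ false → ⊥
true≢false refl ()

all₃-sound : ∀ f → all₃ f ≡ true → ∀ x → f x ≡ true
all₃-sound f e zero = proj₁ (∧-true _ _ e)
all₃-sound f e (suc zero) = proj₁ (∧-true _ _ (proj₂ (∧-true (f zero) _ e)))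
all₃-sound f e (suc (suc zero)) = proj₂ (∧-true _ _ (proj₂ (∧-true (f zero) _ e)))

any₃-sound : ∀ f → any₃ f ≡ true → ∃ λ x → f x ≡ true
any₃-sound f e with ∨-true (f zero) _ e
... | inj₁ h = zero , h
... | inj₂ e' with ∨-true (f (suc zero)) _ e'
...   | inj₁ h = suc zero , h
...   | inj₂ h = suc (suc zero) , h

_⊆?_ : Ty → Ty → Bool
S ⊆? S' = all₃ (λ x → not (at S x) ∨ at S' x)

⊆?-sound : ∀ S S' → S ⊆? S' ≡ true → S ⊆ S'
⊆?-sound S S' e x with at S x | at S' x | all₃-sound (λ x → not (at S x) ∨ at S' x) e x
... | false | false | _ = b≤b
... | false | true  | _ = f≤t
... | true  | true  | _ = b≤b
... | true  | false | ()

⊆-refl : ∀ {S} → S ⊆ S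
⊆-refl x = b≤b

_==_ : Ty → Ty → Bool
(a , b , c) == (a' , b' , c') = iff a a' ∧ iff b b' ∧ iff c c'
  where
  iff : Bool → Bool → Bool
  iff true  b = b
  iff false b = not b

==-sound : ∀ t t' → t == t' ≡ true → t ≡ t'
==-sound (true  , true  , true)  (true  , true  , true)  e = refl
==-sound (true  , true  , false) (true  , true  , false) e = refl
==-sound (true  , false , true)  (true  , false , true)  e = refl
==-sound (true  , false , false) (true  , false , false) e = refl
==-sound (false , true  , true)  (false , true  , true)  e = refl
==-sound (false , true  , false) (false , true  , false) e = refl
==-sound (false , false , true)  (false , false , true)  e = refl
==-sound (false , false , false) (false , false , false) e = refl

types : List Ty
types = (true , true , true) ∷ (true , true , false) ∷ (true , false , true) ∷ (true , false , false) ∷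
        (false , true , true) ∷ (false , true , false) ∷ (false , false , true) ∷ (false , false , false) ∷ []

∈types : ∀ t → t ∈ types
∈types (true  , true  , true)  = here refl
∈types (true  , true  , false) = there (here refl)
∈types (true  , false , true)  = there (there (here refl))
∈types (true  , false , false) = there (there (there (here refl)))
∈types (false , true  , true)  = there (there (there (there (here refl))))
∈types (false , true  , false) = there (there (there (there (there (here refl)))))
∈types (false , false , true)  = there (there (there (there (there (there (here refl))))))
∈types (false , false , false) = there (there (there (there (there (there (there (here refl)))))))

-- Counting vertices by type

bit : Bool → ℕ
bit true  = 1
bit false = 0

count : ∀ {A : Set} → (A → Bool) → List A → ℕ
count f []       = 0
count f (x ∷ xs) = bit (f x) + count f xs

select : ∀ {A : Set} → (A → Bool) → List A → List A
select f [] = []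
select f (x ∷ xs) = if f x then x ∷ select f xs else select f xs

length-select : ∀ {A : Set} (f : A → Bool) xs → length (select f xs) ≡ count f xs
length-select f [] = refl
length-select f (x ∷ xs) with f x
... | true  = cong suc (length-select f xs)
... | false = length-select f xs

∈-select : ∀ {A : Set} (f : A → Bool) {xs x} → x ∈ xs → f x ≡ true → x ∈ select f xs
∈-select f {x ∷ xs} (here refl) e rewrite e = here refl
∈-select f {x ∷ xs} (there m) e with f x
... | true  = there (∈-select f m e)
... | false = ∈-select f m e

count-complement : ∀ {A : Set} (f : A → Bool) xs → count f xs + count (not ∘ f) xs ≡ length xs
count-complement f [] = refl
count-complement f (x ∷ xs) with f x
... | true  = cong suc (count-complement f xs)
... | false = trans (+-suc _ _) (cong suc (count-complement f xs))

length-≤1⇒unique : ∀ {A : Set} {xs : List A} {x y} → length xs ≤ 1 → x ∈ xs → y ∈ xs → x ≡ y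
length-≤1⇒unique {xs = a ∷ []} l (here refl) (here refl) = refl
length-≤1⇒unique {xs = a ∷ b ∷ xs} (s≤s ()) m m'

weight : (Ty → Bool) → (Ty → ℕ) → List Ty → ℕ
weight g h ts = sum (map (λ t → h t * bit (g t)) ts)

weight-+ : ∀ g h h' ts → weight g (λ t → h t + h' t) ts ≡ weight g h ts + weight g h' ts
weight-+ g h h' [] = refl
weight-+ g h h' (t ∷ ts) rewrite weight-+ g h h' ts =
  solve 5 (λ a b c d e → (a :+ b) :* c :+ (d :+ e) := (a :* c :+ d) :+ (b :* c :+ e)) refl
    (h t) (h' t) (bit (g t)) (weight g h ts) (weight g h' ts)
  where open +-*-Solver

weight-0 : ∀ g ts → weight g (λ _ → 0) ts ≡ 0
weight-0 g []       = refl
weight-0 g (t ∷ ts) = weight-0 g ts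

weight-point : ∀ g u → weight g (λ t → bit (u == t)) types ≡ bit (g u)
weight-point g (true  , true  , true)  = trans (+-identityʳ _) (+-identityʳ _)
weight-point g (true  , true  , false) = trans (+-identityʳ _) (+-identityʳ _)
weight-point g (true  , false , true)  = trans (+-identityʳ _) (+-identityʳ _)
weight-point g (true  , false , false) = trans (+-identityʳ _) (+-identityʳ _)
weight-point g (false , true  , true)  = trans (+-identityʳ _) (+-identityʳ _)
weight-point g (false , true  , false) = trans (+-identityʳ _) (+-identityʳ _)
weight-point g (false , false , true)  = trans (+-identityʳ _) (+-identityʳ _)
weight-point g (false , false , false) = trans (+-identityʳ _) (+-identityʳ _)

count-by-type : ∀ {A : Set} (f : A → Ty) g xs →
  count (g ∘ f) xs ≡ weight g (λ t → count (λ y → f y == t) xs) types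
count-by-type f g [] = sym (weight-0 g types)
count-by-type f g (x ∷ xs) =
  trans (cong₂ _+_ (sym (weight-point g (f x))) (count-by-type f g xs)) (sym (weight-+ g (λ t → bit (f x == t)) (λ t → count (λ y → f y == t) xs) types))

weight-mono : ∀ g {h h' : Ty → ℕ} → (∀ t → h t ≤ h' t) → ∀ ts → weight g h ts ≤ weight g h' ts
weight-mono g le [] = z≤n
weight-mono g le (t ∷ ts) = +-mono-≤ (*-monoˡ-≤ (bit (g t)) (le t)) (weight-mono g le ts)

-- A sum of at most 1 has no summand equal to 2, so truncation at 2 has changed nothing in it.
weight-cap : ∀ g {v c : Ty → ℕ} → (∀ t → v t ≡ 2 ⊓ c t) → ∀ ts → weight g v ts ≤ 1 → weight g c ts ≡ weight g v ts
weight-cap g e [] l = refl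
weight-cap g {v} {c} e (t ∷ ts) l =
  cong₂ _+_ (head (≤-trans (m≤m+n _ _) l)) (weight-cap g e ts (≤-trans (m≤n+m _ _) l))
  where
  head : v t * bit (g t) ≤ 1 → c t * bit (g t) ≡ v t * bit (g t)
  head l with g t
  ... | false = trans (*-zeroʳ (c t)) (sym (*-zeroʳ (v t)))
  ... | true rewrite e t with c t
  ...   | 0 = refl
  ...   | 1 = refl
  head (s≤s ()) | true | suc (suc n)

s-mono : ∀ {m n} → m ≤ n → s m ≤ s n
s-mono m≤n = go (≤⇒≤′ m≤n)
  where
  go : ∀ {m n} → m ≤′ n → s m ≤ s n
  go ≤′-refl     = ≤-refl
  go (≤′-step l) = ≤-trans (go l) (m≤m+n _ _)

-- Bounds for the classes of vertices z with the same S z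

-- In turn: an empty class, a class of at most one vertex, and a class on which at least k of the
-- vertices y are constant, so that it is an antichain in a cube of dimension at most p - k.
data Bound : Set where
  none one : Bound
  cut      : ℕ → Bound

value : ℕ → Bound → ℕ
value p none    = 0
value p one     = 1
value p (cut k) = s (p ∸ k)

-- v t stands for the number of y with N y ≡ t, truncated at 2. No z has S z ≡ S if `void S`. If `constant S t` and
-- N y ≡ t, then B z y is the same for all z with S z ≡ S: either S and t are comparable, or y is the only vertex that
-- can serve as the intermediate vertex in `zx` or `xz`.
module _ (v : Ty → ℕ) where

  outs ins : Fin 3 → ℕ
  outs x = weight (λ t → at t x) v types
  ins  x = weight (λ t → not (at t x)) v types

  void : Ty → Bool
  void S = (1 ≤ℕᵇ v S) ∨ any₃ λ x → if at S x then ins x ≤ℕᵇ 0 else (outs x ≤ℕᵇ 0)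

  constant : Ty → Ty → Bool
  constant S t = (S ⊆? t) ∨ (t ⊆? S) ∨
    any₃ λ x → if at S x then not (at t x) ∧ (ins x ≤ℕᵇ 1) else at t x ∧ (outs x ≤ℕᵇ 1)

  -- A truncated weight is exact when it is at most 1 and otherwise only a lower bound for the
  -- number of y, which is what `cut` needs. Cuts beyond 3 are not distinguished.
  bound : Ty → Bound
  bound S = if void S then none else
    (if weight (not ∘ constant S) v types ≤ℕᵇ 1 then one else cut (3 ⊓ weight (constant S) v types))

-- Injections that bound the classes

≤ᵇ-sound : ∀ m n → (m ≤ℕᵇ n) ≡ true → m ≤ n
≤ᵇ-sound m n e = ≤ᵇ⇒≤ m n (subst T (sym e) tt)

-- At most n of the z satisfy P, in the form of an injection, so that the bounds of disjoint classes
-- can be added.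
Within : ∀ {q} → (Fin q → Set) → ℕ → Set
Within {q} P n = Σ ((z : Fin q) → P z → Fin n) λ f → ∀ z z' h h' → f z h ≡ f z' h' → z ≡ z'

within-mono : ∀ {q} {P : Fin q → Set} {m n} → m ≤ n → Within P m → Within P n
within-mono le (f , inj) =
  (λ z h → inject≤ (f z h) le) , λ z z' h h' e → inj z z' h h' (inject≤-injective le le _ _ e)

within-list : ∀ {q} {P : Fin q → Set} {A : Set} (L : List A) (f : Fin q → A) →
  (∀ z → P z → f z ∈ L) → (∀ z z' → P z → P z' → f z ≡ f z' → z ≡ z') → Within P (length L)
within-list L f m inj = (λ z h → index (m z h)) , λ z z' h h' e →
  inj z z' h h' (trans (lookup-index (m z h)) (trans (cong (lookup L) e) (sym (lookup-index (m z' h')))))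

pack : ∀ (n : Ty → ℕ) {t ts} → t ∈ ts → Fin (n t) → Fin (sum (map n ts))
pack n {ts = t ∷ ts} (here refl) i = i ↑ˡ sum (map n ts)
pack n {ts = t ∷ ts} (there m)   i = n t ↑ʳ pack n m i

pack-injective : ∀ (n : Ty → ℕ) {t t' ts} (m : t ∈ ts) (m' : t' ∈ ts) i i' →
  pack n m i ≡ pack n m' i' → _≡_ {A = Σ Ty (Fin ∘ n)} (t , i) (t' , i')
pack-injective n (here refl) (here refl) i i' e with ↑ˡ-injective _ i i' e
... | refl = refl
pack-injective n {ts = t ∷ ts} (here refl) (there m') i i' e
  with trans (sym (splitAt-↑ˡ (n t) i _)) (trans (cong (splitAt (n t)) e) (splitAt-↑ʳ (n t) _ (pack n m' i')))
... | ()
pack-injective n {ts = t ∷ ts} (there m) (here refl) i i' e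
  with trans (sym (splitAt-↑ˡ (n t) i' _)) (trans (cong (splitAt (n t)) (sym e)) (splitAt-↑ʳ (n t) _ (pack n m i)))
... | ()
pack-injective n {ts = t ∷ ts} (there m) (there m') i i' e =
  pack-injective n m m' i i' (↑ʳ-injective (n t) _ _ e)

-- Placing the labels of the eight classes in consecutive blocks gives an injection of all z into
-- the sum.
partition-bound : ∀ {q} (S : Fin q → Ty) (n : Ty → ℕ) → (∀ t → Within (λ z → S z ≡ t) (n t)) → q ≤ sum (map n types)
partition-bound S n w = injective⇒≤ {f = λ z → pack n (∈types (S z)) (proj₁ (w (S z)) z refl)}
  λ {z} {z'} e → go z z' refl refl (pack-injective n (∈types (S z)) (∈types (S z')) _ _ e)
  where
  go : ∀ z z' {t t'} (h : S z ≡ t) (h' : S z' ≡ t') →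
    _≡_ {A = Σ Ty (Fin ∘ n)} (t , proj₁ (w t) z h) (t' , proj₁ (w t') z' h') → z ≡ z'
  go z z' {t} h h' e = split h h' (cong proj₁ e) e
    where
    split : ∀ {t t'} (h : S z ≡ t) (h' : S z' ≡ t') → t ≡ t' →
      _≡_ {A = Σ Ty (Fin ∘ n)} (t , proj₁ (w t) z h) (t' , proj₁ (w t') z' h') → z ≡ z'
    split {t} h h' refl e = proj₂ (w t) z z' h h' (unpair e)
      where
      unpair : ∀ {t} {i j : Fin (n t)} → _≡_ {A = Σ Ty (Fin ∘ n)} (t , i) (t , j) → i ≡ j
      unpair refl = refl

module Classes {p q} (C : Config p q) where
  open Config C

  multiplicity : Ty → ℕ
  multiplicity t = count (λ y → N y == t) (allFin p)

  module _ (v : Ty → ℕ) (v≡ : ∀ t → v t ≡ 2 ⊓ multiplicity t) where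

    weight≤count : ∀ g → weight g v types ≤ count (g ∘ N) (allFin p)
    weight≤count g = subst (weight g v types ≤_) (sym (count-by-type N g (allFin p)))
      (weight-mono g (λ t → subst (_≤ multiplicity t) (sym (v≡ t)) (m⊓n≤n 2 _)) types)

    count≡weight : ∀ g → weight g v types ≤ 1 → count (g ∘ N) (allFin p) ≡ weight g v types
    count≡weight g l = trans (count-by-type N g (allFin p)) (weight-cap g v≡ types l)

    few⇒absent : ∀ g → weight g v types ≤ 0 → ∀ y → g (N y) ≡ true → ⊥
    few⇒absent g l y e with select (g ∘ N) (allFin p) | length-select (g ∘ N) (allFin p) | ∈-select (g ∘ N) (∈-allFin y) e
    ... | _ ∷ _ | e' | _ with trans e' (trans (count≡weight g (≤-trans l z≤n)) (n≤0⇒n≡0 l))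
    ...   | ()

    few⇒unique : ∀ g → weight g v types ≤ 1 → ∀ y y' → g (N y) ≡ true → g (N y') ≡ true → y ≡ y'
    few⇒unique g l y y' e e' = length-≤1⇒unique
      (subst (_≤ 1) (sym (trans (length-select (g ∘ N) (allFin p)) (count≡weight g l))) l)
      (∈-select (g ∘ N) (∈-allFin y) e) (∈-select (g ∘ N) (∈-allFin y') e')

    -- A y with N y ≡ S z would have B z y both `true` by `zy` and `false` by `yz`. In the other
    -- case `xz` or `zx` asks for a y that does not exist.
    void-sound : ∀ z → void v (S z) ≡ true → ⊥
    void-sound z e with ∨-true (1 ≤ℕᵇ v (S z)) _ e
    ... | inj₁ h = exists (≤-trans (≤ᵇ-sound 1 _ h) (subst (_≤ multiplicity (S z)) (sym (v≡ (S z))) (m⊓n≤n 2 _)))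
      where
      occurs : ∀ ys → 1 ≤ count (λ y → N y == S z) ys → ∃ λ y → N y == S z ≡ true
      occurs (y ∷ ys) l with N y == S z in eq
      ... | true  = y , eq
      ... | false = occurs ys l
      exists : 1 ≤ multiplicity (S z) → ⊥
      exists l with occurs (allFin p) l
      ... | y , e with ==-sound (N y) (S z) e
      ...   | e' = true≢false (zy z y (subst (S z ⊆_) (sym e') ⊆-refl)) (yz z y (subst (_⊆ S z) (sym e') ⊆-refl))
    ... | inj₂ h with any₃-sound (λ x → if at (S z) x then ins v x ≤ℕᵇ 0 else (outs v x ≤ℕᵇ 0)) h
    ...   | x , h' with at (S z) x in eq
    ...     | true  with xz z x eq
    ...       | y , _ , n = few⇒absent (λ t → not (at t x)) (≤ᵇ-sound _ 0 h') y (cong not n)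
    void-sound z e | inj₂ h | x , h' | false with zx z x eq
    ...       | y , _ , n = few⇒absent (λ t → at t x) (≤ᵇ-sound _ 0 h') y n

    constant-sound : ∀ z z' y → S z ≡ S z' → constant v (S z) (N y) ≡ true → B z y ≡ B z' y
    constant-sound z z' y e c with ∨-true (S z ⊆? N y) _ c
    ... | inj₁ h = trans (zy z y (⊆?-sound _ _ h)) (sym (zy z' y (subst (_⊆ N y) e (⊆?-sound _ _ h))))
    ... | inj₂ c' with ∨-true (N y ⊆? S z) _ c'
    ...   | inj₁ h = trans (yz z y (⊆?-sound _ _ h)) (sym (yz z' y (subst (N y ⊆_) e (⊆?-sound _ _ h))))
    ...   | inj₂ c″ with any₃-sound (λ x → if at (S z) x then not (at (N y) x) ∧ (ins v x ≤ℕᵇ 1) else at (N y) x ∧ (outs v x ≤ℕᵇ 1)) c″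
    ...     | x , h with at (S z) x in eq
    ...       | true with ∧-true (not (at (N y) x)) _ h
    ...         | n , l = trans (val z eq) (sym (val z' (trans (cong (λ t → at t x) (sym e)) eq)))
      where
      val : ∀ z → at (S z) x ≡ true → B z y ≡ false
      val z eq with xz z x eq
      ... | y' , b , n' = subst (λ y → B z y ≡ false)
        (few⇒unique (λ t → not (at t x)) (≤ᵇ-sound _ 1 l) y' y (cong not n') n) b
    constant-sound z z' y e c | inj₂ c' | inj₂ c″ | x , h | false with ∧-true (at (N y) x) _ h
    ...         | n , l = trans (val z eq) (sym (val z' (trans (cong (λ t → at t x) (sym e)) eq)))
      where
      val : ∀ z → at (S z) x ≡ false → B z y ≡ true
      val z eq with zx z x eq
      ... | y' , b , n' = subst (λ y → B z y ≡ true)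
        (few⇒unique (λ t → at t x) (≤ᵇ-sound _ 1 l) y' y n' n) b

    -- Sperner's bound through the chain partition: z is labelled by the code of its row on the
    -- vertices y that are not constant. Two z with the same code have comparable rows, and `zz`
    -- identifies them.
    class-sperner : ∀ t → Within (λ z → S z ≡ t) (s (count (not ∘ constant v t ∘ N) (allFin p)))
    class-sperner t = subst (Within _) size (within-list (ballots (length free) 0) label member injective)
      where
      free : List (Fin p)
      free = select (not ∘ constant v t ∘ N) (allFin p)
      size : length (ballots (length free) 0) ≡ s (count (not ∘ constant v t ∘ N) (allFin p))
      size = trans (length-ballots₀ (length free)) (cong s (length-select _ (allFin p)))
      label : Fin q → List Bool
      label z = code (map (B z) free) 0 0
      member : ∀ z → S z ≡ t → label z ∈ ballots (length free) 0
      member z _ = subst (λ n → label z ∈ ballots n 0) (length-map (B z) free) (code∈ballots (map (B z) free) 0 0)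
      below : ∀ z z' → S z ≡ t → S z' ≡ t → Pointwise _≤ᵇ_ (map (B z) free) (map (B z') free) → z ≡ z'
      below z z' h h' pw = zz z z' (subst (_⊆ S z') (trans h' (sym h)) ⊆-refl) le
        where
        le : ∀ y → B z y ≤ᵇ B z' y
        le y with constant v t (N y) in eq
        ... | true  = subst (B z y ≤ᵇ_) (constant-sound z z' y (trans h (sym h')) (subst (λ t → constant v t (N y) ≡ true) (sym h) eq)) b≤b
        ... | false = map-≤-lookup pw (∈-select _ (∈-allFin y) (cong not eq))
      injective : ∀ z z' → S z ≡ t → S z' ≡ t → label z ≡ label z' → z ≡ z'
      injective z z' h h' e with same-code⇒comparable (map (B z) free) (map (B z') free) e
      ... | inj₁ pw = below z z' h h' pw
      ... | inj₂ pw = sym (below z' z h' h pw)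

    class-bound : ∀ t → Within (λ z → S z ≡ t) (value p (bound v t))
    class-bound t with void v t in eq
    ... | true = (λ z h → ⊥-elim (void-sound z (subst (λ t → void v t ≡ true) (sym h) eq))) ,
                 (λ z z' h _ _ → ⊥-elim (void-sound z (subst (λ t → void v t ≡ true) (sym h) eq)))
    ... | false with weight (not ∘ constant v t) v types ≤ℕᵇ 1 in eq'
    -- With at most one free vertex y, the class has at most s 1 = 1 element.
    ...   | true = within-mono (s-mono (subst (_≤ 1) (sym (count≡weight (not ∘ constant v t) few)) few)) (class-sperner t)
      where few = ≤ᵇ-sound (weight (not ∘ constant v t) v types) 1 eq'
    ...   | false = within-mono (s-mono le) (class-sperner t)
      where
      k = weight (constant v t) v types
      a = count (constant v t ∘ N) (allFin p)
      b = count (not ∘ constant v t ∘ N) (allFin p)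
      le : b ≤ p ∸ (3 ⊓ k)
      le = subst (_≤ p ∸ (3 ⊓ k)) (trans (cong (_∸ a) (trans (sym (length-tabulate id)) (sym (count-complement (constant v t ∘ N) (allFin p))))) (m+n∸m≡n a b))
        (∸-monoʳ-≤ p (≤-trans (m⊓n≤n 3 k) (weight≤count (constant v t))))

    classes-bound : q ≤ sum (map (value p ∘ bound v) types)
    classes-bound = partition-bound S (value p ∘ bound v) class-bound

-- Comparison with the central binomial coefficient

Poly : Set
Poly = ℕ × ℕ × ℕ × ℕ × ℕ

-- (a , b , c , d , k) stands for a * r n 0 + b * r n 1 + c * r n 2 + d * r n 3 + k.
eval : ℕ → Poly → ℕ
eval n (a , b , c , d , k) = a * r n 0 + b * r n 1 + c * r n 2 + d * r n 3 + k

_⊕_ : Poly → Poly → Poly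
(a , b , c , d , k) ⊕ (a' , b' , c' , d' , k') = (a + a' , b + b' , c + c' , d + d' , k + k')

eval-⊕ : ∀ n P Q → eval n (P ⊕ Q) ≡ eval n P + eval n Q
eval-⊕ n (a , b , c , d , k) (a' , b' , c' , d' , k') =
  solve 14 (λ a b c d k a' b' c' d' k' w x y z →
      (a :+ a') :* w :+ (b :+ b') :* x :+ (c :+ c') :* y :+ (d :+ d') :* z :+ (k :+ k') :=
      (a :* w :+ b :* x :+ c :* y :+ d :* z :+ k) :+ (a' :* w :+ b' :* x :+ c' :* y :+ d' :* z :+ k'))
    refl a b c d k a' b' c' d' k' (r n 0) (r n 1) (r n 2) (r n 3)
  where open +-*-Solver

-- The recursion of `r` expands s (3 + n), s (2 + n) and s (1 + n) in terms of r n 0, ..., r n 3.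
poly : Bound → Poly
poly none                      = 0 , 0 , 0 , 0 , 0
poly one                       = 0 , 0 , 0 , 0 , 1
poly (cut 0)                   = 3 , 3 , 1 , 1 , 0
poly (cut 1)                   = 2 , 1 , 1 , 0 , 0
poly (cut 2)                   = 1 , 1 , 0 , 0 , 0
poly (cut (suc (suc (suc k)))) = 1 , 0 , 0 , 0 , 0

value≤eval : ∀ n b → value (3 + n) b ≤ eval n (poly b)
value≤eval n none    = z≤n
value≤eval n one     = ≤-refl
value≤eval n (cut 0) = ≤-reflexive (solve 4 (λ w x y z →
    ((w :+ x) :+ (w :+ y)) :+ ((w :+ x) :+ (x :+ z)) :=
    con 3 :* w :+ con 3 :* x :+ con 1 :* y :+ con 1 :* z :+ con 0) refl (r n 0) (r n 1) (r n 2) (r n 3))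
  where open +-*-Solver
value≤eval n (cut 1) = ≤-reflexive (solve 4 (λ w x y z →
    (w :+ x) :+ (w :+ y) := con 2 :* w :+ con 1 :* x :+ con 1 :* y :+ con 0 :* z :+ con 0) refl (r n 0) (r n 1) (r n 2) (r n 3))
  where open +-*-Solver
value≤eval n (cut 2) = ≤-reflexive (solve 4 (λ w x y z →
    w :+ x := con 1 :* w :+ con 1 :* x :+ con 0 :* y :+ con 0 :* z :+ con 0) refl (r n 0) (r n 1) (r n 2) (r n 3))
  where open +-*-Solver
value≤eval n (cut (suc (suc (suc k)))) = ≤-trans (s-mono (m∸n≤m n k)) (≤-reflexive (solve 1 (λ w →
    w := con 1 :* w :+ con 0 :+ con 0 :+ con 0 :+ con 0) refl (r n 0)))
  where open +-*-Solver

total : List Bound → Poly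
total []       = 0 , 0 , 0 , 0 , 0
total (b ∷ bs) = poly b ⊕ total bs

values≤total : ∀ n (f : Ty → Bound) ts → sum (map (value (3 + n) ∘ f) ts) ≤ eval n (total (map f ts))
values≤total n f []       = z≤n
values≤total n f (t ∷ ts) = subst (value (3 + n) (f t) + sum (map (value (3 + n) ∘ f) ts) ≤_)
  (sym (eval-⊕ n (poly (f t)) (total (map f ts)))) (+-mono-≤ (value≤eval n (f t)) (values≤total n f ts))

r-antitone : ∀ n j → r n (suc j) ≤ r n j
r-antitone zero    j       = z≤n
r-antitone (suc n) zero    = +-monoʳ-≤ (r n 0) (r-antitone n 1)
r-antitone (suc n) (suc j) = +-mono-≤ (r-antitone n j) (r-antitone n (suc (suc j)))

r₂-positive : ∀ n → 1 ≤ r (2 + n) 2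
r₂-positive zero    = ≤-refl
r₂-positive (suc n) = ≤-trans (r₂-positive n) (≤-trans (r-antitone (2 + n) 1) (m≤m+n _ _))

-- A sufficient condition for eval n P < s (4 + n) = 6 r₀ + 4 r₁ + 4 r₂ + r₃ + r₄, from r₀ ≥ r₁ and r₀, r₁, r₂ ≥ 1.
small : Poly → Bool
small (a , b , c , d , k) =
  (a + (b ∸ 4) ≤ℕᵇ 6) ∧ (c ≤ℕᵇ 4) ∧ (d ≤ℕᵇ 1) ∧ (suc k ≤ℕᵇ (6 ∸ (a + (b ∸ 4))) + (4 ∸ b) + (4 ∸ c))

small-sound : ∀ n P → 2 ≤ n → small P ≡ true → eval n P < s (4 + n)
small-sound (suc (suc n)) (a , b , c , d , k) (s≤s (s≤s z≤n)) h
  with ∧-true (a + (b ∸ 4) ≤ℕᵇ 6) _ h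
... | ha , h₁ with ∧-true (c ≤ℕᵇ 4) _ h₁
...   | hc , h₂ with ∧-true (d ≤ℕᵇ 1) _ h₂
...     | hd , hk = begin-strict
  a * w + b * x + c * y + d * z + k
    <⟨ +-monoʳ-< (a * w + b * x + c * y + d * z) (≤ᵇ-sound (suc k) _ hk) ⟩
  a * w + b * x + c * y + d * z + (e + f + g)
    ≤⟨ +-mono-≤ (+-monoʳ-≤ (a * w + b * x + c * y) (*-monoˡ-≤ z (≤ᵇ-sound d 1 hd)))
         (+-mono-≤ (+-mono-≤ (scale e w≥1) (scale f x≥1)) (scale g y≥1)) ⟩
  a * w + b * x + c * y + 1 * z + (e * w + f * x + g * y)
    ≡⟨ solve 10 (λ a b c e f g w x y z →
         a :* w :+ b :* x :+ c :* y :+ con 1 :* z :+ (e :* w :+ f :* x :+ g :* y) :=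
         (a :+ e) :* w :+ (b :+ f) :* x :+ (c :+ g) :* y :+ z) refl a b c e f g w x y z ⟩
  (a + e) * w + (b + f) * x + (c + g) * y + z
    ≡⟨ cong₂ (λ m m' → (a + e) * w + m * x + m' * y + z) b+f (m+[n∸m]≡n (≤ᵇ-sound c 4 hc)) ⟩
  (a + e) * w + (4 + (b ∸ 4)) * x + 4 * y + z
    ≡⟨ cong (λ m → (a + e) * w + m + 4 * y + z) (*-distribʳ-+ x 4 (b ∸ 4)) ⟩
  (a + e) * w + (4 * x + (b ∸ 4) * x) + 4 * y + z
    -- The copies of x beyond the fourth are charged to w.
    ≤⟨ +-monoˡ-≤ z (+-monoˡ-≤ (4 * y) (+-monoʳ-≤ ((a + e) * w) (+-monoʳ-≤ (4 * x) (*-monoʳ-≤ (b ∸ 4) (r-antitone (2 + n) 0))))) ⟩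
  (a + e) * w + (4 * x + (b ∸ 4) * w) + 4 * y + z
    ≡⟨ solve 7 (λ a e b w x y z →
         (a :+ e) :* w :+ (con 4 :* x :+ b :* w) :+ con 4 :* y :+ z :=
         (a :+ b :+ e) :* w :+ con 4 :* x :+ con 4 :* y :+ z) refl a e (b ∸ 4) w x y z ⟩
  (a + (b ∸ 4) + e) * w + 4 * x + 4 * y + z
    ≡⟨ cong (λ m → m * w + 4 * x + 4 * y + z) (m+[n∸m]≡n (≤ᵇ-sound (a + (b ∸ 4)) 6 ha)) ⟩
  6 * w + 4 * x + 4 * y + z
    ≤⟨ m≤m+n _ (r (2 + n) 4) ⟩
  6 * w + 4 * x + 4 * y + z + r (2 + n) 4
    ≡⟨ solve 5 (λ w x y z u →
         con 6 :* w :+ con 4 :* x :+ con 4 :* y :+ z :+ u :=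
         (((w :+ x) :+ (w :+ y)) :+ ((w :+ x) :+ (x :+ z))) :+ (((w :+ x) :+ (w :+ y)) :+ ((w :+ y) :+ (y :+ u))))
         refl w x y z (r (2 + n) 4) ⟩
  s (6 + n) ∎
  where
  open ≤-Reasoning
  open +-*-Solver
  w = r (2 + n) 0
  x = r (2 + n) 1
  y = r (2 + n) 2
  z = r (2 + n) 3
  e = 6 ∸ (a + (b ∸ 4))
  f = 4 ∸ b
  g = 4 ∸ c
  y≥1 : 1 ≤ y
  y≥1 = r₂-positive n
  x≥1 : 1 ≤ x
  x≥1 = ≤-trans y≥1 (r-antitone (2 + n) 1)
  w≥1 : 1 ≤ w
  w≥1 = ≤-trans x≥1 (r-antitone (2 + n) 0)
  scale : ∀ m {o} → 1 ≤ o → m ≤ m * o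
  scale m {o} l = subst (_≤ m * o) (*-identityʳ m) (*-monoʳ-≤ m l)
  swap∸ : ∀ m n → m + (n ∸ m) ≡ n + (m ∸ n)
  swap∸ zero    zero    = refl
  swap∸ zero    (suc n) = sym (cong suc (+-identityʳ n))
  swap∸ (suc m) zero    = cong suc (+-identityʳ m)
  swap∸ (suc m) (suc n) = cong suc (swap∸ m n)
  b+f : b + f ≡ 4 + (b ∸ 4)
  b+f = swap∸ b 4

-- The finite check over tables of truncated multiplicities

look : Vec ℕ 8 → Ty → ℕ
look (a ∷ b ∷ c ∷ d ∷ e ∷ f ∷ g ∷ h ∷ []) = λ where
  (true  , true  , true)  → a
  (true  , true  , false) → b
  (true  , false , true)  → c
  (true  , false , false) → d
  (false , true  , true)  → e
  (false , true  , false) → f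
  (false , false , true)  → g
  (false , false , false) → h

special : Vec ℕ 8 → Bool
special v = any₃ λ k → any₃ λ i → weight (λ t → not (at t k ∧ not (at t i))) (look v) types ≤ℕᵇ 0

allUpTo2 : ∀ n → (Vec ℕ n → Bool) → Bool
allUpTo2 zero    f = f []
allUpTo2 (suc n) f = allUpTo2 n (f ∘ (0 ∷_)) ∧ allUpTo2 n (f ∘ (1 ∷_)) ∧ allUpTo2 n (f ∘ (2 ∷_))

allUpTo2-sound : ∀ {n} f → allUpTo2 n f ≡ true → ∀ v → VAll.All (_≤ 2) v → f v ≡ true
allUpTo2-sound f h [] [] = h
allUpTo2-sound {suc n} f h (0 ∷ v) (_ ∷ l) =
  allUpTo2-sound (f ∘ (0 ∷_)) (proj₁ (∧-true _ _ h)) v l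
allUpTo2-sound {suc n} f h (1 ∷ v) (_ ∷ l) =
  allUpTo2-sound (f ∘ (1 ∷_)) (proj₁ (∧-true _ _ (proj₂ (∧-true (allUpTo2 n (f ∘ (0 ∷_))) _ h)))) v l
allUpTo2-sound {suc n} f h (2 ∷ v) (_ ∷ l) =
  allUpTo2-sound (f ∘ (2 ∷_)) (proj₂ (∧-true (allUpTo2 n (f ∘ (1 ∷_))) _ (proj₂ (∧-true (allUpTo2 n (f ∘ (0 ∷_))) _ h)))) v l
allUpTo2-sound f h (suc (suc (suc _)) ∷ v) (s≤s (s≤s ()) ∷ l)

-- An evaluation over the 3⁸ possible tables of truncated multiplicities.
special-or-small : ∀ v → VAll.All (_≤ 2) v → special v ∨ small (total (map (bound (look v)) types)) ≡ true
special-or-small = allUpTo2-sound (λ v → special v ∨ small (total (map (bound (look v)) types))) refl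

-- The case in which all N y contain k and avoid i

-- The path that only rises, which is the code of the longest chain, heads the list; the tail is
-- then a list of the codes of all other chains.
replicate∈ballots : ∀ n j → ∃ λ L → ballots n j ≡ replicate n true ∷ L
replicate∈ballots zero j = [] , refl
replicate∈ballots (suc n) zero with replicate∈ballots n 1
... | L , e = map (true ∷_) L , cong (map (true ∷_)) e
replicate∈ballots (suc n) (suc j) with replicate∈ballots n (suc (suc j))
... | L , e = map (true ∷_) L ++ map (false ∷_) (ballots n j) , cong (λ K → map (true ∷_) K ++ map (false ∷_) (ballots n j)) e

-- While a `false` is pending, the next `true` would be matched and put a `false` into the code.
unmatched-falses : ∀ v i d n → code v i (suc d) ≡ replicate n true → All (_≡ false) v
unmatched-falses []          i d n       e = []
unmatched-falses (false ∷ v) i d (suc n) e = refl ∷ unmatched-falses v i (suc d) n (∷-injectiveʳ e)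
unmatched-falses (true ∷ v)  i d zero    ()
unmatched-falses (true ∷ v)  i d (suc n) ()

-- The words whose code has no `false` are those of the longest chain, true … true false … false.
longest-chain : ∀ u x v i n → code (u ++ x ∷ v) i 0 ≡ replicate n true →
  (All (_≡ true) u × x ≡ true) ⊎ (x ≡ false × All (_≡ false) v)
longest-chain [] true  v i n       e = inj₁ ([] , refl)
longest-chain [] false v i (suc n) e = inj₂ (refl , unmatched-falses v i 0 n (∷-injectiveʳ e))
longest-chain (true ∷ u) x v i (suc n) e with longest-chain u x v (suc i) n (∷-injectiveʳ e)
... | inj₁ (a , h) = inj₁ (refl ∷ a , h)
... | inj₂ h       = inj₂ h
longest-chain (false ∷ u) x v i (suc n) e with ++⁻ʳ u (unmatched-falses (u ++ x ∷ v) i 0 n (∷-injectiveʳ e))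
... | h ∷ a = inj₂ (h , a)

third : (i k : Fin 3) → i ≢ k → ∃ λ j → ∀ x → x ≡ i ⊎ x ≡ j ⊎ x ≡ k
third zero zero i≢k = ⊥-elim (i≢k refl)
third zero (suc zero) _ = suc (suc zero) , λ { zero → inj₁ refl ; (suc zero) → inj₂ (inj₂ refl) ; (suc (suc zero)) → inj₂ (inj₁ refl) }
third zero (suc (suc zero)) _ = suc zero , λ { zero → inj₁ refl ; (suc zero) → inj₂ (inj₁ refl) ; (suc (suc zero)) → inj₂ (inj₂ refl) }
third (suc zero) zero _ = suc (suc zero) , λ { zero → inj₂ (inj₂ refl) ; (suc zero) → inj₁ refl ; (suc (suc zero)) → inj₂ (inj₁ refl) }
third (suc zero) (suc zero) i≢k = ⊥-elim (i≢k refl)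
third (suc zero) (suc (suc zero)) _ = zero , λ { zero → inj₂ (inj₁ refl) ; (suc zero) → inj₁ refl ; (suc (suc zero)) → inj₂ (inj₂ refl) }
third (suc (suc zero)) zero _ = suc zero , λ { zero → inj₂ (inj₂ refl) ; (suc zero) → inj₂ (inj₁ refl) ; (suc (suc zero)) → inj₁ refl }
third (suc (suc zero)) (suc zero) _ = zero , λ { zero → inj₂ (inj₁ refl) ; (suc zero) → inj₂ (inj₂ refl) ; (suc (suc zero)) → inj₁ refl }
third (suc (suc zero)) (suc (suc zero)) i≢k = ⊥-elim (i≢k refl)

module Special {p q} (K : Config p q) (i k : Fin 3) (i≢k : i ≢ k)
  (k∈N : ∀ y → at (Config.N K y) k ≡ true) (i∉N : ∀ y → at (Config.N K y) i ≡ false) where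
  open Config K

  j : Fin 3
  j = proj₁ (third i k i≢k)

  i∈S : ∀ z → at (S z) i ≡ true
  i∈S z with at (S z) i in e
  ... | true  = refl
  ... | false with zx z i e
  ...   | y , _ , h = ⊥-elim (true≢false h (i∉N y))

  k∉S : ∀ z → at (S z) k ≡ false
  k∉S z with at (S z) k in e
  ... | false = refl
  ... | true  with xz z k e
  ...   | y , _ , h = ⊥-elim (true≢false (k∈N y) h)

  low high : List (Fin p)
  low  = select (λ y → not (at (N y) j)) (allFin p)
  high = select (λ y → at (N y) j) (allFin p)

  -- Since every S z contains i and avoids k, only the bit of j and the row of z vary. The bit of j
  -- separates the low y from the high y so that the longest chain consists of words forbidden by
  -- `xz` and `zx`.
  word : Fin q → List Bool
  word z = map (B z) low ++ at (S z) j ∷ map (B z) high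

  length-word : ∀ z → length (word z) ≡ suc p
  length-word z = begin
    length (word z)                              ≡⟨ length-++ (map (B z) low) ⟩
    length (map (B z) low) + suc (length (map (B z) high))
      ≡⟨ cong₂ (λ a b → a + suc b) (length-map (B z) low) (length-map (B z) high) ⟩
    length low + suc (length high)               ≡⟨ +-suc (length low) (length high) ⟩
    suc (length low + length high)               ≡⟨ cong suc (cong₂ _+_ (length-select _ (allFin p)) (length-select _ (allFin p))) ⟩
    suc (count (λ y → not (at (N y) j)) (allFin p) + count (λ y → at (N y) j) (allFin p)) ≡⟨ cong suc (+-comm (count _ (allFin p)) _) ⟩
    suc (count (λ y → at (N y) j) (allFin p) + count (λ y → not (at (N y) j)) (allFin p))
      ≡⟨ cong suc (count-complement (λ y → at (N y) j) (allFin p)) ⟩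
    suc (length (allFin p))                      ≡⟨ cong suc (length-tabulate id) ⟩
    suc p                                        ∎
    where open ≡-Reasoning

  split-word : ∀ {A : Set} {f g : A → Bool} {a b} xs {u v} →
    Pointwise _≤ᵇ_ (map f xs ++ a ∷ u) (map g xs ++ b ∷ v) → Pointwise _≤ᵇ_ (map f xs) (map g xs) × a ≤ᵇ b × Pointwise _≤ᵇ_ u v
  split-word []       (h ∷ pw) = [] , h , pw
  split-word (x ∷ xs) (h ∷ pw) with split-word xs pw
  ... | pw₁ , h' , pw₂ = h ∷ pw₁ , h' , pw₂

  below : ∀ z z' → Pointwise _≤ᵇ_ (word z) (word z') → z ≡ z'
  below z z' pw with split-word low pw
  ... | pl , h , ph = zz z z' S≤ B≤
    where
    S≤ : S z ⊆ S z'
    S≤ x with proj₂ (third i k i≢k) x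
    ... | inj₁ refl        = subst₂ _≤ᵇ_ (sym (i∈S z)) (sym (i∈S z')) b≤b
    ... | inj₂ (inj₁ refl) = h
    ... | inj₂ (inj₂ refl) = subst₂ _≤ᵇ_ (sym (k∉S z)) (sym (k∉S z')) b≤b
    B≤ : ∀ y → B z y ≤ᵇ B z' y
    B≤ y with at (N y) j in e
    ... | true  = map-≤-lookup ph (∈-select _ (∈-allFin y) e)
    ... | false = map-≤-lookup pl (∈-select _ (∈-allFin y) (cong not e))

  mapped : ∀ {A : Set} {f : A → Bool} {b xs x} → All (_≡ b) (map f xs) → x ∈ xs → f x ≡ b
  mapped (e ∷ _) (here refl) = e
  mapped (_ ∷ a) (there m)   = mapped a m

  -- On the longest chain, either j ∈ S z and B z y is `true` for all low y, against `xz`, or j ∉ S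
  -- z and B z y is `false` for all high y, against `zx`.
  avoids : ∀ z → code (word z) 0 0 ≢ replicate (suc p) true
  avoids z e with longest-chain (map (B z) low) (at (S z) j) (map (B z) high) 0 (suc p) e
  ... | inj₁ (a , h) with xz z j h
  ...   | y , b , n = true≢false (mapped a (∈-select _ (∈-allFin y) (cong not n))) b
  avoids z e | inj₂ (h , a) with zx z j h
  ...   | y , b , n = true≢false b (mapped a (∈-select _ (∈-allFin y) n))

  -- The codes of the z are distinct and lie among the s (suc p) - 1 codes other than that of the
  -- longest chain.
  q<s : q < s (suc p)
  q<s with replicate∈ballots (suc p) 0
  ... | L , e = subst (q <_) (trans (sym (cong length e)) (length-ballots₀ (suc p))) (s≤s bound-q)
    where
    member : ∀ z → ⊤ → code (word z) 0 0 ∈ L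
    member z _ with subst (code (word z) 0 0 ∈_) e (subst (λ n → code (word z) 0 0 ∈ ballots n 0) (length-word z) (code∈ballots (word z) 0 0))
    ... | here h  = ⊥-elim (avoids z h)
    ... | there m = m
    injective : ∀ z z' → ⊤ → ⊤ → code (word z) 0 0 ≡ code (word z') 0 0 → z ≡ z'
    injective z z' _ _ e with same-code⇒comparable (word z) (word z') e
    ... | inj₁ pw = below z z' pw
    ... | inj₂ pw = sym (below z' z pw)
    bound-q : q ≤ length L
    bound-q with within-list L (λ z → code (word z) 0 0) member injective
    ... | f , inj = injective⇒≤ {f = λ z → f z tt} (inj _ _ tt tt)

config-bound : ∀ {p q} → 5 ≤ p → Config p q → q < s (suc p)
config-bound {suc (suc (suc n))} {q} (s≤s (s≤s (s≤s 2≤n))) K = conclude (∨-true (special v) _ (special-or-small v v≤2))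
  where
  open Config K
  open Classes K
  truncated : Ty → ℕ
  truncated t = 2 ⊓ multiplicity t
  v : Vec ℕ 8
  v = truncated (true , true , true) ∷ truncated (true , true , false) ∷
      truncated (true , false , true) ∷ truncated (true , false , false) ∷
      truncated (false , true , true) ∷ truncated (false , true , false) ∷
      truncated (false , false , true) ∷ truncated (false , false , false) ∷ []
  v≤2 : VAll.All (_≤ 2) v
  v≤2 = h _ ∷ h _ ∷ h _ ∷ h _ ∷ h _ ∷ h _ ∷ h _ ∷ h _ ∷ []
    where
    h : ∀ t → 2 ⊓ multiplicity t ≤ 2
    h t = m⊓n≤m 2 _
  look-v : ∀ t → look v t ≡ 2 ⊓ multiplicity t
  look-v (true  , true  , true)  = refl
  look-v (true  , true  , false) = refl
  look-v (true  , false , true)  = refl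
  look-v (true  , false , false) = refl
  look-v (false , true  , true)  = refl
  look-v (false , true  , false) = refl
  look-v (false , false , true)  = refl
  look-v (false , false , false) = refl
  conclude : special v ≡ true ⊎ small (total (map (bound (look v)) types)) ≡ true → q < s (suc (3 + n))
  conclude (inj₂ h) = ≤-<-trans (≤-trans (classes-bound (look v) look-v) (values≤total n (bound (look v)) types))
    (small-sound n (total (map (bound (look v)) types)) 2≤n h)
  conclude (inj₁ h) with any₃-sound (λ k → any₃ λ i → weight (λ t → not (at t k ∧ not (at t i))) (look v) types ≤ℕᵇ 0) h
  ... | k , h' with any₃-sound (λ i → weight (λ t → not (at t k ∧ not (at t i))) (look v) types ≤ℕᵇ 0) h'
  ...   | i , few = Special.q<s K i k i≢k (proj₁ ∘ both) (proj₂ ∘ both)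
    where
    both : ∀ y → at (N y) k ≡ true × at (N y) i ≡ false
    both y with at (N y) k ∧ not (at (N y) i) in e
    ... | true with ∧-true (at (N y) k) _ e
    ...   | a , b = a , not-true b
    both y | false = ⊥-elim (few⇒absent (look v) look-v (λ t → not (at t k ∧ not (at t i))) (≤ᵇ-sound _ 0 few) y (cong not e))
    i≢k : i ≢ k
    i≢k refl = true≢false (proj₁ (both zero)) (proj₂ (both zero))

-- Vertices of the complete tripartite graph

data Vertex (p q : ℕ) : Set where
  X : Fin 3 → Vertex p q
  Y : Fin p → Vertex p q
  Z : Fin q → Vertex p q

kind : ∀ {p q} → Vertex p q → ℕ
kind (X _) = 0
kind (Y _) = 1
kind (Z _) = 2

encode : ∀ {p q} → Vertex p q → Fin (3 + p + q)
encode {p} {q} (X x) = (x ↑ˡ p) ↑ˡ q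
encode {p} {q} (Y y) = (3 ↑ʳ y) ↑ˡ q
encode {p} {q} (Z z) = (3 + p) ↑ʳ z

decode : ∀ p q → Fin (3 + p + q) → Vertex p q
decode p q u = [ [ X , Y ]′ ∘ splitAt 3 , Z ]′ (splitAt (3 + p) u)

decode-encode : ∀ {p q} (a : Vertex p q) → decode p q (encode a) ≡ a
decode-encode {p} {q} (X x) rewrite splitAt-↑ˡ (3 + p) (x ↑ˡ p) q | splitAt-↑ˡ 3 x p = refl
decode-encode {p} {q} (Y y) rewrite splitAt-↑ˡ (3 + p) (3 ↑ʳ y) q | splitAt-↑ʳ 3 p y = refl
decode-encode {p} {q} (Z z) rewrite splitAt-↑ʳ (3 + p) q z = refl

encode-decode : ∀ p q u → encode (decode p q u) ≡ u
encode-decode p q u with splitAt (3 + p) u | join-splitAt (3 + p) q u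
... | inj₂ z | e = e
... | inj₁ t | e with splitAt 3 t | join-splitAt 3 p t
...   | inj₁ x | refl = e
...   | inj₂ y | refl = e

part-0 : ∀ a b c u → toℕ u < a → part a b c u ≡ 0
part-0 a b c u l with toℕ u <? a
... | yes _ = refl
... | no h  = ⊥-elim (h l)

part-1 : ∀ a b c u → a ≤ toℕ u → toℕ u < a + b → part a b c u ≡ 1
part-1 a b c u l l' with toℕ u <? a
... | yes h = ⊥-elim (<⇒≱ h l)
... | no _ with toℕ u <? a + b
...   | yes _ = refl
...   | no h  = ⊥-elim (h l')

part-2 : ∀ a b c u → a + b ≤ toℕ u → part a b c u ≡ 2
part-2 a b c u l with toℕ u <? a
... | yes h = ⊥-elim (<⇒≱ h (≤-trans (m≤m+n a b) l))
... | no _ with toℕ u <? a + b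
...   | yes h = ⊥-elim (<⇒≱ h l)
...   | no _  = refl

part-encode : ∀ {p q} (a : Vertex p q) → part 3 p q (encode a) ≡ kind a
part-encode {p} {q} (X x) = part-0 3 p q (encode {p} {q} (X x)) (subst (_< 3) (sym (trans (toℕ-↑ˡ (x ↑ˡ p) q) (toℕ-↑ˡ x p))) (toℕ<n x))
part-encode {p} {q} (Y y) = part-1 3 p q (encode {p} {q} (Y y)) (subst (3 ≤_) (sym e) (m≤m+n 3 (toℕ y))) (subst (_< 3 + p) (sym e) (+-monoʳ-< 3 (toℕ<n y)))
  where
  e : toℕ (encode {p} {q} (Y y)) ≡ 3 + toℕ y
  e = trans (toℕ-↑ˡ (3 ↑ʳ y) q) (toℕ-↑ʳ 3 y)
part-encode {p} {q} (Z z) = part-2 3 p q (encode {p} {q} (Z z)) (subst (3 + p ≤_) (sym (toℕ-↑ʳ (3 + p) z)) (m≤m+n (3 + p) (toℕ z)))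

encode-injective : ∀ {p q} (a b : Vertex p q) → encode a ≡ encode b → a ≡ b
encode-injective {p} {q} a b e = trans (sym (decode-encode a)) (trans (cong (decode p q) e) (decode-encode b))

same-kind⇒nonadjacent : ∀ {p q} (a b : Vertex p q) → kind a ≡ kind b → ¬ K3 3 p q (encode a) (encode b)
same-kind⇒nonadjacent a b e g = g (trans (part-encode a) (trans e (sym (part-encode b))))

-- Extracting a configuration from an orientation

Near : ∀ {n} → Digraph n → Fin n → Fin n → Set
Near D u v = u ≡ v ⊎ D u v ≡ true ⊎ ∃ λ w → D u w ≡ true × D w v ≡ true

DistLe⇒Near : ∀ {n} {D : Digraph n} {u v} → DistLe D u v 2 → Near D u v
DistLe⇒Near (_ , _ , here) = inj₁ refl
DistLe⇒Near (_ , _ , step h here) = inj₂ (inj₁ h)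
DistLe⇒Near (_ , _ , step h (step h' here)) = inj₂ (inj₂ (_ , h , h'))
DistLe⇒Near (_ , s≤s (s≤s ()) , step _ (step _ (step _ _)))

DistLe-mono : ∀ {n} {D : Digraph n} {u v d d'} → d ≤ d' → DistLe D u v d → DistLe D u v d'
DistLe-mono le (l , h , w) = l , ≤-trans h le , w

≤-true : ∀ {m n} → m ≤ᵇ n → m ≡ true → n ≡ true
≤-true b≤b e = e

module Extract {p q} (D : Digraph (3 + p + q)) (orientation : IsOrientation (K3 3 p q) D)
  (near : ∀ u v → DistLe D u v 2) where

  edge : Vertex p q → Vertex p q → Bool
  edge a b = D (encode a) (encode b)

  edge⇒kind≢ : ∀ a b → edge a b ≡ true → kind a ≢ kind b
  edge⇒kind≢ a b h e = proj₁ orientation (encode a) (encode b) h (trans (part-encode a) (trans e (sym (part-encode b))))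

  asym : ∀ a b → edge a b ≡ true → edge b a ≡ false
  asym a b = proj₂ (proj₂ orientation) (encode a) (encode b)

  near-vertices : ∀ a b → a ≡ b ⊎ edge a b ≡ true ⊎ ∃ λ c → edge a c ≡ true × edge c b ≡ true
  near-vertices a b with DistLe⇒Near (near (encode a) (encode b))
  ... | inj₁ e = inj₁ (encode-injective a b e)
  ... | inj₂ (inj₁ h) = inj₂ (inj₁ h)
  ... | inj₂ (inj₂ (w , h , h')) = inj₂ (inj₂ (decode p q w ,
          subst (λ w → D (encode a) w ≡ true) (sym (encode-decode p q w)) h ,
          subst (λ w → D w (encode b) ≡ true) (sym (encode-decode p q w)) h'))

  outX : Vertex p q → Ty
  outX a = edge a (X zero) , edge a (X (suc zero)) , edge a (X (suc (suc zero)))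

  at-outX : ∀ a x → at (outX a) x ≡ edge a (X x)
  at-outX a zero             = refl
  at-outX a (suc zero)       = refl
  at-outX a (suc (suc zero)) = refl

  ⊆⇒edge : ∀ a b → outX a ⊆ outX b → ∀ x → edge a (X x) ≡ true → edge b (X x) ≡ true
  ⊆⇒edge a b le x h = ≤-true (subst₂ _≤ᵇ_ (at-outX a x) (at-outX b x) (le x)) h

  -- The middle vertex of a path of length 2 lies in neither end's part. Between z and y it must lie
  -- in X and between z and x in Y; containment of out-neighbourhoods in X or Y rules out a middle
  -- vertex there, because its second arc would have to be reversed.
  config : Config p q
  config .Config.N = outX ∘ Y
  config .Config.S = outX ∘ Z
  config .Config.B z y = edge (Z z) (Y y)
  config .Config.zz z z' le le' with near-vertices (Z z) (Z z')
  ... | inj₁ refl = refl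
  ... | inj₂ (inj₁ h) = ⊥-elim (edge⇒kind≢ (Z z) (Z z') h refl)
  ... | inj₂ (inj₂ (X x , h , h')) = ⊥-elim (true≢false h' (asym (Z z') (X x) (⊆⇒edge (Z z) (Z z') le x h)))
  ... | inj₂ (inj₂ (Y y , h , h')) = ⊥-elim (true≢false h' (asym (Z z') (Y y) (≤-true (le' y) h)))
  ... | inj₂ (inj₂ (Z w , h , h')) = ⊥-elim (edge⇒kind≢ (Z z) (Z w) h refl)
  config .Config.zy z y le with near-vertices (Z z) (Y y)
  ... | inj₂ (inj₁ h) = h
  ... | inj₂ (inj₂ (X x , h , h')) = ⊥-elim (true≢false h' (asym (Y y) (X x) (⊆⇒edge (Z z) (Y y) le x h)))
  ... | inj₂ (inj₂ (Y w , h , h')) = ⊥-elim (edge⇒kind≢ (Y w) (Y y) h' refl)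
  ... | inj₂ (inj₂ (Z w , h , h')) = ⊥-elim (edge⇒kind≢ (Z z) (Z w) h refl)
  config .Config.yz z y le with near-vertices (Y y) (Z z)
  ... | inj₂ (inj₁ h) = asym (Y y) (Z z) h
  ... | inj₂ (inj₂ (X x , h , h')) = ⊥-elim (true≢false h' (asym (Z z) (X x) (⊆⇒edge (Y y) (Z z) le x h)))
  ... | inj₂ (inj₂ (Y w , h , h')) = ⊥-elim (edge⇒kind≢ (Y y) (Y w) h refl)
  ... | inj₂ (inj₂ (Z w , h , h')) = ⊥-elim (edge⇒kind≢ (Z w) (Z z) h' refl)
  config .Config.zx z x e with near-vertices (Z z) (X x)
  ... | inj₂ (inj₁ h) = ⊥-elim (true≢false h (trans (sym (at-outX (Z z) x)) e))
  ... | inj₂ (inj₂ (X w , h , h')) = ⊥-elim (edge⇒kind≢ (X w) (X x) h' refl)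
  ... | inj₂ (inj₂ (Y y , h , h')) = y , h , trans (at-outX (Y y) x) h'
  ... | inj₂ (inj₂ (Z w , h , h')) = ⊥-elim (edge⇒kind≢ (Z z) (Z w) h refl)
  config .Config.xz z x e with near-vertices (X x) (Z z)
  ... | inj₂ (inj₁ h) = ⊥-elim (true≢false (trans (sym (at-outX (Z z) x)) e) (asym (X x) (Z z) h))
  ... | inj₂ (inj₂ (X w , h , h')) = ⊥-elim (edge⇒kind≢ (X x) (X w) h refl)
  ... | inj₂ (inj₂ (Y y , h , h')) = y , asym (Y y) (Z z) h' , trans (at-outX (Y y) x) (asym (X x) (Y y) h)
  ... | inj₂ (inj₂ (Z w , h , h')) = ⊥-elim (edge⇒kind≢ (Z w) (Z z) h' refl)

diameter-2⇒few : ∀ {p q} → 5 ≤ p → (D : Digraph (3 + p + q)) → IsOrientation (K3 3 p q) D →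
  (∀ u v → DistLe D u v 2) → q < s (suc p)
diameter-2⇒few 5≤p D o near = config-bound 5≤p (Extract.config D o near)

-- Orientations given by tables of bits

module Build {p q} (N : Fin p → Fin 3 → Bool) (S : Fin q → Fin 3 → Bool) (B : Fin q → Fin p → Bool) where

  arc : Vertex p q → Vertex p q → Bool
  arc (X x) (Y y) = not (N y x)
  arc (Y y) (X x) = N y x
  arc (X x) (Z z) = not (S z x)
  arc (Z z) (X x) = S z x
  arc (Y y) (Z z) = not (B z y)
  arc (Z z) (Y y) = B z y
  arc (X _) (X _) = false
  arc (Y _) (Y _) = false
  arc (Z _) (Z _) = false

  digraph : Digraph (3 + p + q)
  digraph u v = arc (decode p q u) (decode p q v)

  arc⇒kind≢ : ∀ a b → arc a b ≡ true → kind a ≢ kind b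
  arc⇒kind≢ (X x) (Y y) h ()
  arc⇒kind≢ (Y y) (X x) h ()
  arc⇒kind≢ (X x) (Z z) h ()
  arc⇒kind≢ (Z z) (X x) h ()
  arc⇒kind≢ (Y y) (Z z) h ()
  arc⇒kind≢ (Z z) (Y y) h ()

  either : ∀ m → not m ≡ true ⊎ m ≡ true
  either false = inj₁ refl
  either true  = inj₂ refl

  arc-total : ∀ a b → kind a ≢ kind b → arc a b ≡ true ⊎ arc b a ≡ true
  arc-total (X x) (Y y) n = either (N y x)
  arc-total (Y y) (X x) n = swap (either (N y x))
  arc-total (X x) (Z z) n = either (S z x)
  arc-total (Z z) (X x) n = swap (either (S z x))
  arc-total (Y y) (Z z) n = either (B z y)
  arc-total (Z z) (Y y) n = swap (either (B z y))
  arc-total (X _) (X _) n = ⊥-elim (n refl)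
  arc-total (Y _) (Y _) n = ⊥-elim (n refl)
  arc-total (Z _) (Z _) n = ⊥-elim (n refl)

  arc-asym : ∀ a b → arc a b ≡ true → arc b a ≡ false
  arc-asym (X x) (Y y) h = not-true h
  arc-asym (Y y) (X x) h = cong not h
  arc-asym (X x) (Z z) h = not-true h
  arc-asym (Z z) (X x) h = cong not h
  arc-asym (Y y) (Z z) h = not-true h
  arc-asym (Z z) (Y y) h = cong not h

  part≡kind : ∀ u → part 3 p q u ≡ kind (decode p q u)
  part≡kind u = trans (cong (part 3 p q) (sym (encode-decode p q u))) (part-encode (decode p q u))

  isOrientation : IsOrientation (K3 3 p q) digraph
  isOrientation =
    (λ u v h e → arc⇒kind≢ (decode p q u) (decode p q v) h (trans (sym (part≡kind u)) (trans e (part≡kind v)))) ,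
    (λ u v n → arc-total (decode p q u) (decode p q v) (λ e → n (trans (part≡kind u) (trans e (sym (part≡kind v)))))) ,
    (λ u v → arc-asym (decode p q u) (decode p q v))

  -- Walks on vertices rather than on their codes, so that `arc` computes; `path⇒walk` transfers
  -- them.
  data Path : ℕ → Vertex p q → Vertex p q → Set where
    stop : ∀ {a} → Path 0 a a
    _then_ : ∀ {a b c l} → arc a b ≡ true → Path l b c → Path (suc l) a c

  infixr 5 _then_

  path⇒walk : ∀ {l} u v → Path l (decode p q u) (decode p q v) → Walk digraph l u v
  path⇒walk {l} u v w = subst₂ (Walk digraph l) (encode-decode p q u) (encode-decode p q v) (lift w)
    where
    lift : ∀ {l a b} → Path l a b → Walk digraph l (encode a) (encode b)
    lift stop = here
    lift (_then_ {a} {b} h w) = step (subst₂ (λ a b → arc a b ≡ true) (sym (decode-encode a)) (sym (decode-encode b)) h) (lift w)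

  distances : ∀ {d} → (∀ a b → ∃ λ l → l ≤ d × Path l a b) → ∀ u v → DistLe digraph u v d
  distances near u v with near (decode p q u) (decode p q v)
  ... | l , le , w = l , le , path⇒walk u v w

  strong : ∀ {d} → (∀ a b → ∃ λ l → l ≤ d × Path l a b) → StrongOrientation (K3 3 p q) digraph
  strong near = isOrientation , λ u v → proj₁ (distances near u v) , proj₂ (proj₂ (distances near u v))

no-short-walk : ∀ {n} {D : Digraph n} {G : Graph n} → IsOrientation G D → ∀ {u v} → u ≢ v → ¬ G u v →
  ∀ l → l < 2 → ¬ Walk D l u v
no-short-walk o n g 0 _ here = n refl
no-short-walk o n g 1 _ (step h here) = g (proj₁ o _ _ h)
no-short-walk o n g (suc (suc l)) (s≤s (s≤s ())) w

-- Two vertices of X are distinct and not adjacent.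
diameter≥2 : ∀ {p q} → 1 ≤ p → (D : Digraph (3 + p + q)) (d : ℕ) → IsOrientation (K3 3 p q) D → HasDiam D d → 2 ≤ d
diameter≥2 {p} {q} 1≤p D d o (near , _) with 2 ≤? d
... | yes h = h
... | no h with near (encode {p} {q} (X zero)) (encode {p} {q} (X (suc zero)))
...   | l , le , w = ⊥-elim (no-short-walk o (λ ()) (λ n → n refl) l (≤-<-trans le (≰⇒> h)) w)

-- Orientations attaining the bounds

-- The blow-up of a directed triangle X → Y → Z → X.
module Triangle {p q} (y₀ : Fin p) (z₀ : Fin q) where
  open Build {p} {q} (λ _ _ → false) (λ _ _ → true) (λ _ _ → false) public

  near : ∀ a b → ∃ λ l → l ≤ 3 × Path l a b
  near (X x) (X x') = 3 , ≤-refl , (_then_ {b = Y y₀} refl (_then_ {b = Z z₀} refl (_then_ refl stop)))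
  near (X x) (Y y)  = 1 , s≤s z≤n , (_then_ refl stop)
  near (X x) (Z z)  = 2 , s≤s (s≤s z≤n) , (_then_ {b = Y y₀} refl (_then_ refl stop))
  near (Y y) (X x)  = 2 , s≤s (s≤s z≤n) , (_then_ {b = Z z₀} refl (_then_ refl stop))
  near (Y y) (Y y') = 3 , ≤-refl , (_then_ {b = Z z₀} refl (_then_ {b = X zero} refl (_then_ refl stop)))
  near (Y y) (Z z)  = 1 , s≤s z≤n , (_then_ refl stop)
  near (Z z) (X x)  = 1 , s≤s z≤n , (_then_ refl stop)
  near (Z z) (Y y)  = 2 , s≤s (s≤s z≤n) , (_then_ {b = X zero} refl (_then_ refl stop))
  near (Z z) (Z z') = 3 , ≤-refl , (_then_ {b = X zero} refl (_then_ {b = Y y₀} refl (_then_ refl stop)))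

  -- Arcs lead only from X to Y, from Y to Z and from Z to X, so a walk between vertices of Z has
  -- length divisible by 3.
  far : ∀ z z' → z ≢ z' → ∀ l → l < 3 → ¬ Walk digraph l (encode {p} {q} (Z z)) (encode {p} {q} (Z z'))
  far z z' n 0 _ w = no-short-walk isOrientation (λ e → n (Z-injective (encode-injective (Z z) (Z z') e)))
    (same-kind⇒nonadjacent {p} {q} (Z z) (Z z') refl) 0 (s≤s z≤n) w
    where
    Z-injective : ∀ {z z' : Fin q} → _≡_ {A = Vertex p q} (Z z) (Z z') → z ≡ z'
    Z-injective refl = refl
  far z z' n 1 _ (step h here) =
    same-kind⇒nonadjacent {p} {q} (Z z) (Z z') refl (proj₁ isOrientation (encode (Z z)) (encode (Z z')) h)
  far z z' n 2 _ (step {v = w} h (step h' here)) = middle (decode p q w)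
      (subst (λ a → arc a (decode p q w) ≡ true) (decode-encode {p} {q} (Z z)) h)
      (subst (λ a → arc (decode p q w) a ≡ true) (decode-encode {p} {q} (Z z')) h')
    where
    middle : ∀ a → arc (Z z) a ≡ true → arc a (Z z') ≡ true → ⊥
    middle (X x) _ ()
    middle (Y y) () _
    middle (Z w) () _
  far z z' n (suc (suc (suc _))) (s≤s (s≤s (s≤s ()))) w

-- A diameter of at most 2 would force q < s (suc p) by `diameter-2⇒few`. The triangle blow-up
-- attains 3 between two distinct vertices of Z, hence the pattern for q.
oriented-diameter-3 : ∀ {p q} → 5 ≤ p → p ≤ q → s (suc p) ≤ q → OrientedDiam (K3 3 p q) 3
oriented-diameter-3 {suc p} {suc (suc q)} 5≤p p≤q s≤q =
  (digraph , strong near , distances near , encode {suc p} (Z zero) , encode {suc p} (Z (suc zero)) , far zero (suc zero) (λ ())) , minimal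
  where
  open Triangle {suc p} {suc (suc q)} zero zero
  minimal : ∀ D d → StrongOrientation (K3 3 (suc p) (suc (suc q))) D → HasDiam D d → 3 ≤ d
  minimal D d (o , _) (dist , _) with 3 ≤? d
  ... | yes h = h
  ... | no h  = ⊥-elim (<⇒≱ (diameter-2⇒few 5≤p D o (λ u v → DistLe-mono (≤-pred (≰⇒> h)) (dist u v))) s≤q)
oriented-diameter-3 {suc p} {suc zero} (s≤s (s≤s _)) (s≤s ()) _
oriented-diameter-3 {suc p} {zero} _ () _

-- The extremal shape from the exceptional case of the upper bound: every N y contains x₂ and avoids
-- x₀, every S z contains x₀ and avoids x₂, and only x₁ varies, through `high` and `c`. The
-- hypotheses provide the middle vertices that these choices leave open.
module Diameter2 {p q} (high : Fin p → Bool) (c : Fin q → Bool) (B : Fin q → Fin p → Bool)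
  (some-high : ∃ λ y → high y ≡ true)
  (some-low : ∃ λ y → high y ≡ false)
  (hit : ∀ y → ∃ λ z → B z y ≡ true)
  (hit-high : ∀ y → high y ≡ true → ∃ λ z → c z ≡ false × B z y ≡ true)
  (miss : ∀ y → ∃ λ z → c z ≡ true × B z y ≡ false)
  (separate : ∀ y y' → y ≢ y' → (high y ≡ true × high y' ≡ false) ⊎ ∃ λ z → B z y ≡ false × B z y' ≡ true)
  (contains : ∀ z → ∃ λ y → B z y ≡ true)
  (contains-high : ∀ z → c z ≡ false → ∃ λ y → high y ≡ true × B z y ≡ true)
  (omits : ∀ z → ∃ λ y → B z y ≡ false)
  (omits-low : ∀ z → c z ≡ true → ∃ λ y → high y ≡ false × B z y ≡ false)
  (incomparable : ∀ z z' → z ≢ z' → (c z ≡ true × c z' ≡ false) ⊎ ∃ λ y → B z y ≡ true × B z' y ≡ false)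
  where

  N : Fin p → Fin 3 → Bool
  N y zero             = false
  N y (suc zero)       = high y
  N y (suc (suc zero)) = true

  S : Fin q → Fin 3 → Bool
  S z zero             = true
  S z (suc zero)       = c z
  S z (suc (suc zero)) = false

  open Build N S B public

  Reach : Vertex p q → Vertex p q → Set
  Reach a b = ∃ λ l → l ≤ 2 × Path l a b

  itself : ∀ a → Reach a a
  itself a = 0 , z≤n , stop

  direct : ∀ {a b} → arc a b ≡ true → Reach a b
  direct h = 1 , s≤s z≤n , (h then stop)

  via : ∀ {a b} m → arc a m ≡ true → arc m b ≡ true → Reach a b
  via m h h' = 2 , ≤-refl , (h then h' then stop)

  x₀ x₁ x₂ : Fin 3
  x₀ = zero
  x₁ = suc zero
  x₂ = suc (suc zero)

  y-high y-low : Fin p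
  y-high = proj₁ some-high
  y-low  = proj₁ some-low

  near : ∀ a b → Reach a b
  near (X zero) (X zero) = itself _
  near (X zero) (X (suc zero)) = via (Y y-high) refl (proj₂ some-high)
  near (X zero) (X (suc (suc zero))) = via (Y y-high) refl refl
  near (X (suc zero)) (X zero) with hit-high y-high (proj₂ some-high)
  ... | z , h , _ = via (Z z) (cong not h) refl
  near (X (suc zero)) (X (suc zero)) = itself _
  near (X (suc zero)) (X (suc (suc zero))) = via (Y y-low) (cong not (proj₂ some-low)) refl
  near (X (suc (suc zero))) (X zero) with miss y-low
  ... | z , h , _ = via (Z z) refl refl
  near (X (suc (suc zero))) (X (suc zero)) with miss y-low
  ... | z , h , _ = via (Z z) refl h
  near (X (suc (suc zero))) (X (suc (suc zero))) = itself _
  near (X zero) (Y y) = direct refl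
  near (X (suc zero)) (Y y) with high y in e
  ... | false = direct (cong not e)
  ... | true with hit-high y e
  ...   | z , h , h' = via (Z z) (cong not h) h'
  near (X (suc (suc zero))) (Y y) with hit y
  ... | z , h = via (Z z) refl h
  near (Y y) (X zero) with miss y
  ... | z , _ , h = via (Z z) (cong not h) refl
  near (Y y) (X (suc zero)) with miss y
  ... | z , h , h' = via (Z z) (cong not h') h
  near (Y y) (X (suc (suc zero))) = direct refl
  near (Y y) (Y y') with y ≟ᶠ y'
  ... | yes refl = itself _
  ... | no n with separate y y' n
  ...   | inj₁ (h , h') = via (X x₁) h (cong not h')
  ...   | inj₂ (z , h , h') = via (Z z) (cong not h) h'
  near (X zero) (Z z) with omits z
  ... | y , h = via (Y y) refl (cong not h)
  near (X (suc zero)) (Z z) with c z in e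
  ... | false = direct (cong not e)
  ... | true with omits-low z e
  ...   | y , h , h' = via (Y y) (cong not h) (cong not h')
  near (X (suc (suc zero))) (Z z) = direct refl
  near (Z z) (X zero) = direct refl
  near (Z z) (X (suc zero)) with c z in e
  ... | true  = direct e
  ... | false with contains-high z e
  ...   | y , h , h' = via (Y y) h' h
  near (Z z) (X (suc (suc zero))) with contains z
  ... | y , h = via (Y y) h refl
  -- The paths y → x₂ → z and z → x₀ → y are present for all y and z.
  near (Y y) (Z z) with B z y in e
  ... | false = direct (cong not e)
  ... | true  = via (X x₂) refl refl
  near (Z z) (Y y) with B z y in e
  ... | true  = direct e
  ... | false = via (X x₀) refl refl
  near (Z z) (Z z') with z ≟ᶠ z'
  ... | yes refl = itself _
  ... | no n with incomparable z z' n
  ...   | inj₁ (h , h') = via (X x₁) h (cong not h')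
  ...   | inj₂ (y , h , h') = via (Y y) h (cong not h')

  oriented-diameter-2 : 1 ≤ p → OrientedDiam (K3 3 p q) 2
  oriented-diameter-2 1≤p =
    (digraph , strong near , distances near , encode {p} {q} (X zero) , encode {p} {q} (X (suc zero)) ,
      no-short-walk isOrientation (λ ()) (λ n → n refl)) ,
    λ D d o h → diameter≥2 1≤p D d (proj₁ o) h

-- Words of length n with k entries `true`

get : List Bool → ℕ → Bool
get []      j       = false
get (b ∷ u) zero    = b
get (b ∷ u) (suc j) = get u j

get-applyUpTo : ∀ f {n j} → j < n → get (applyUpTo f n) j ≡ f j
get-applyUpTo f {suc n} {zero}  l       = refl
get-applyUpTo f {suc n} {suc j} (s≤s l) = get-applyUpTo (f ∘ suc) l

ones : List Bool → ℕ
ones = count id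

IsWord : ℕ → ℕ → List Bool → Set
IsWord n k u = length u ≡ n × ones u ≡ k

-- The inequality, in place of equal numbers of `true`s, survives the induction: a `false` of u
-- against a `true` of v leaves the rest of u strictly heavier, so the rests cannot be equal.
separate-words : ∀ u v → length u ≡ length v → ones v ≤ ones u →
  (∃ λ j → j < length u × get u j ≡ true × get v j ≡ false) ⊎ u ≡ v
separate-words [] [] e l = inj₂ refl
separate-words (true ∷ u) (false ∷ v) e l = inj₁ (0 , s≤s z≤n , refl , refl)
separate-words (true ∷ u) (true ∷ v) e (s≤s l) with separate-words u v (suc-injective e) l
... | inj₁ (j , j< , h) = inj₁ (suc j , s≤s j< , h)
... | inj₂ refl = inj₂ refl
separate-words (false ∷ u) (false ∷ v) e l with separate-words u v (suc-injective e) l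
... | inj₁ (j , j< , h) = inj₁ (suc j , s≤s j< , h)
... | inj₂ refl = inj₂ refl
separate-words (false ∷ u) (true ∷ v) e l with separate-words u v (suc-injective e) (<⇒≤ l)
... | inj₁ (j , j< , h) = inj₁ (suc j , s≤s j< , h)
... | inj₂ refl = ⊥-elim (1+n≰n l)

words : ℕ → ℕ → List (List Bool)
words zero    zero    = [] ∷ []
words zero    (suc k) = []
words (suc n) zero    = map (false ∷_) (words n zero)
words (suc n) (suc k) = map (true ∷_) (words n k) ++ map (false ∷_) (words n (suc k))

length-words : ∀ n k → length (words n k) ≡ n C k
length-words zero    zero    = refl
length-words zero    (suc k) = refl
length-words (suc n) zero    = trans (length-map _ (words n zero)) (length-words n zero)
length-words (suc n) (suc k) = begin
  length (map (true ∷_) (words n k) ++ map (false ∷_) (words n (suc k)))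
    ≡⟨ length-++ (map (true ∷_) (words n k)) ⟩
  length (map (true ∷_) (words n k)) + length (map (false ∷_) (words n (suc k)))
    ≡⟨ cong₂ _+_ (length-map _ (words n k)) (length-map _ (words n (suc k))) ⟩
  length (words n k) + length (words n (suc k))
    ≡⟨ cong₂ _+_ (length-words n k) (length-words n (suc k)) ⟩
  n C k + n C suc k
    ≡⟨ nCk+nC[k+1]≡[n+1]C[k+1] n k ⟩
  suc n C suc k ∎
  where open ≡-Reasoning

words-sound : ∀ n k {u} → u ∈ words n k → IsWord n k u
words-sound zero zero (here refl) = refl , refl
words-sound (suc n) zero m with ∈-map⁻ (false ∷_) m
... | v , m' , refl with words-sound n zero m'
...   | l , o = cong suc l , o
words-sound (suc n) (suc k) m with ∈-++⁻ (map (true ∷_) (words n k)) m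
... | inj₁ m₁ with ∈-map⁻ (true ∷_) m₁
...   | v , m' , refl with words-sound n k m'
...     | l , o = cong suc l , cong suc o
words-sound (suc n) (suc k) m | inj₂ m₂ with ∈-map⁻ (false ∷_) m₂
...   | v , m' , refl with words-sound n (suc k) m'
...     | l , o = cong suc l , o

words-unique : ∀ n k → Unique (words n k)
words-unique zero    zero    = [] ∷ []
words-unique zero    (suc k) = []
words-unique (suc n) zero    = unique-map⁺ ∷-injectiveʳ (words-unique n zero)
words-unique (suc n) (suc k) = unique-++⁺ (unique-map⁺ ∷-injectiveʳ (words-unique n k))
  (unique-map⁺ ∷-injectiveʳ (words-unique n (suc k))) λ (m , m') → disjoint (∈-map⁻ (true ∷_) m) (∈-map⁻ (false ∷_) m')
  where
  disjoint : ∀ {u L L'} → (∃ λ v → v ∈ L × u ≡ true ∷ v) → (∃ λ v → v ∈ L' × u ≡ false ∷ v) → ⊥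
  disjoint (v , _ , refl) (v' , _ , ())

-- Lists without repetition

lookup-injective : ∀ {A : Set} {xs : List A} → Unique xs → ∀ i j → lookup xs i ≡ lookup xs j → i ≡ j
lookup-injective (h ∷ u) zero zero e = refl
lookup-injective (h ∷ u) zero (suc j) e = ⊥-elim (All.lookup h (∈-lookup j) e)
lookup-injective (h ∷ u) (suc i) zero e = ⊥-elim (All.lookup h (∈-lookup i) (sym e))
lookup-injective (h ∷ u) (suc i) (suc j) e = cong suc (lookup-injective u i j e)

unique-⊆⇒length≤ : ∀ {A : Set} {xs ys : List A} → Unique xs → (∀ {x} → x ∈ xs → x ∈ ys) → length xs ≤ length ys
unique-⊆⇒length≤ {xs = xs} {ys} u sub = injective⇒≤ {f = λ i → index (sub (∈-lookup {xs = xs} i))} λ {i} {j} e →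
  lookup-injective u i j (trans (lookup-index (sub (∈-lookup i))) (trans (cong (lookup ys) e) (sym (lookup-index (sub (∈-lookup j))))))

fresh : ∀ {K L : List (List Bool)} → Unique K → length L < length K → ∃ λ u → u ∈ K × u ∉ L
fresh {K} {L} uK l with any? (λ u → ¬? (u ∈? L)) K
... | yes a = find a
... | no n = ⊥-elim (<⇒≱ l (unique-⊆⇒length≤ uK λ {u} m → decidable-stable (u ∈? L) λ h → n (lose m h)))

-- Repetitions and copies of P are dropped, so the cyclic intervals need not be shown to be
-- distinct; a bound on the length is enough.
insert-all : ∀ (P : List Bool) ws → ∃ λ R → Unique (P ∷ R) × (∀ {w} → w ∈ ws → w ∈ P ∷ R) ×
  (∀ {w} → w ∈ R → w ∈ ws) × length R ≤ length ws
insert-all P [] = [] , [] ∷ [] , (λ ()) , (λ ()) , z≤n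
insert-all P (w ∷ ws) with insert-all P ws
... | R , u , sub , sup , l with w ∈? (P ∷ R)
...   | yes m = R , u , (λ { (here refl) → m ; (there m') → sub m' }) , there ∘ sup , m≤n⇒m≤1+n l
...   | no n = w ∷ R , cons u n , (λ { (here refl) → there (here refl) ; (there m') → skip (sub m') }) ,
               (λ { (here refl) → here refl ; (there m') → there (sup m') }) , s≤s l
  where
  skip : ∀ {v} → v ∈ P ∷ R → v ∈ P ∷ w ∷ R
  skip (here e)  = here e
  skip (there m) = there (there m)

  cons : Unique (P ∷ R) → w ∉ P ∷ R → Unique (P ∷ w ∷ R)
  cons (h ∷ u) n = ((λ e → n (here (sym e))) ∷ h) ∷ (All.tabulate (λ m e → n (there (subst (_∈ R) (sym e) m))) ∷ u)

-- Fresh words of K are added one at a time. The strict inequality q < length K leaves room for P,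
-- which stays excluded.
extend : ∀ {K} (P : List Bool) R → Unique K → Unique (P ∷ R) → ∀ q → length R ≤ q → q < length K →
  ∃ λ R' → Unique (P ∷ R') × (∀ {w} → w ∈ R → w ∈ R') × (∀ {w} → w ∈ R' → w ∈ R ⊎ w ∈ K) × length R' ≡ q
extend {K} P R uK u q l l' with m≤n⇒∃[o]m+o≡n l
... | j , refl = go j l'
  where
  go : ∀ j → length R + j < length K →
    ∃ λ R' → Unique (P ∷ R') × (∀ {w} → w ∈ R → w ∈ R') × (∀ {w} → w ∈ R' → w ∈ R ⊎ w ∈ K) × length R' ≡ length R + j
  go zero    _ = R , u , id , inj₁ , sym (+-identityʳ _)
  go (suc j) l with go j (<-trans (+-monoʳ-< (length R) (n<1+n j)) l)
  ... | R' , u' , sub , sup , e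
    with fresh {K} {P ∷ R'} uK (subst (_< length K) (sym (trans (cong suc e) (sym (+-suc (length R) j)))) l)
  ...   | w , w∈K , w∉ = w ∷ R' , cons u' , there ∘ sub , (λ { (here refl) → inj₂ w∈K ; (there m) → sup m }) ,
      trans (cong suc e) (sym (+-suc (length R) j))
    where
    cons : Unique (P ∷ R') → Unique (P ∷ w ∷ R')
    cons (h ∷ u) = ((λ e → w∉ (here (sym e))) ∷ h) ∷ (All.tabulate (λ m e → w∉ (there (subst (_∈ R') (sym e) m))) ∷ u)

-- Numbers of `true`s in words given by functions, and cyclic intervals

ones-cong : ∀ {f g : ℕ → Bool} → (∀ j → f j ≡ g j) → ∀ n → ones (applyUpTo f n) ≡ ones (applyUpTo g n)
ones-cong e zero    = refl
ones-cong e (suc n) = cong₂ (λ b m → bit b + m) (e 0) (ones-cong (e ∘ suc) n)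

ones-slide : ∀ f n → bit (f 0) + ones (applyUpTo (f ∘ suc) n) ≡ ones (applyUpTo f n) + bit (f n)
ones-slide f zero    = +-comm (bit (f 0)) 0
ones-slide f (suc n) = begin
  bit (f 0) + (bit (f 1) + ones (applyUpTo (λ j → f (suc (suc j))) n)) ≡⟨ cong (bit (f 0) +_) (ones-slide (f ∘ suc) n) ⟩
  bit (f 0) + (ones (applyUpTo (f ∘ suc) n) + bit (f (suc n))) ≡⟨ +-assoc (bit (f 0)) _ _ ⟨
  bit (f 0) + ones (applyUpTo (f ∘ suc) n) + bit (f (suc n)) ∎
  where open ≡-Reasoning

ones-block : ∀ k m f → (∀ j → j < k → f j ≡ true) → (∀ j → k ≤ j → j < k + m → f j ≡ false) → ones (applyUpTo f (k + m)) ≡ k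
ones-block zero zero f t h = refl
ones-block zero (suc m) f t h rewrite h 0 z≤n (s≤s z≤n) = ones-block zero m (f ∘ suc) (λ _ ()) (λ j _ l → h (suc j) z≤n (s≤s l))
ones-block (suc k) m f t h rewrite t 0 (s≤s z≤n) =
  cong suc (ones-block k m (f ∘ suc) (λ j l → t (suc j) (s≤s l)) (λ j l l' → h (suc j) (s≤s l) (s≤s l')))

ones-complement : ∀ f n → ones (applyUpTo f n) + ones (applyUpTo (not ∘ f) n) ≡ n
ones-complement f zero = refl
ones-complement f (suc n) with f 0
... | true  = cong suc (ones-complement (f ∘ suc) n)
... | false = trans (+-suc _ _) (cong suc (ones-complement (f ∘ suc) n))

ones-point : ∀ n k → ones (applyUpTo (_≡ᵇ k) n) ≤ 1
ones-point zero    k       = z≤n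
ones-point (suc n) zero    = s≤s (≤-reflexive (vacant n))
  where
  vacant : ∀ n → ones (applyUpTo (λ j → suc j ≡ᵇ 0) n) ≡ 0
  vacant zero    = refl
  vacant (suc n) = vacant n
ones-point (suc n) (suc k) = ones-point n k

-- The cyclic intervals {j < n : (i + j) mod n < k}, for 0 ≤ i ≤ n, where k = 1 + k'; i = 0 and i = n give the same one.
module Window (n k' : ℕ) (2k≤n : suc k' + suc k' ≤ n) where

  k : ℕ
  k = suc k'

  k<n : k < n
  k<n = ≤-trans (s≤s (≤-reflexive (sym (+-identityʳ k)))) (≤-trans (≤-reflexive (sym (+-suc k 0))) (≤-trans (+-monoʳ-≤ k (s≤s z≤n)) 2k≤n))

  -- The indicator of t mod n < k on the two periods t < n + n, written without division; i + j
  -- stays in this range for i ≤ n and j < n.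
  w : ℕ → Bool
  w t = if does (t <? n) then does (t <? k) else does (t <? n + k)

  w-start : ∀ {t} → t < k → w t ≡ true
  w-start {t} l rewrite dec-true (t <? n) (<-trans l k<n) = dec-true (t <? k) l

  w-gap : ∀ {t} → k ≤ t → t < n → w t ≡ false
  w-gap {t} l l' rewrite dec-true (t <? n) l' = dec-false (t <? k) (≤⇒≯ l)

  w-wrap : ∀ {t} → n ≤ t → t < n + k → w t ≡ true
  w-wrap {t} l l' rewrite dec-false (t <? n) (≤⇒≯ l) = dec-true (t <? n + k) l'

  w-end : ∀ {t} → n + k ≤ t → w t ≡ false
  w-end {t} l rewrite dec-false (t <? n) (≤⇒≯ (≤-trans (m≤m+n n k) l)) = dec-false (t <? n + k) (≤⇒≯ l)

  w-periodic : ∀ i → i < n → w (i + n) ≡ w i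
  w-periodic i l with i <? k
  ... | yes h = trans (w-wrap (m≤n+m n i) (subst (i + n <_) (+-comm k n) (+-monoˡ-< n h))) (sym (w-start h))
  ... | no h  = trans (w-end (subst (_≤ i + n) (+-comm k n) (+-monoˡ-≤ n (≮⇒≥ h)))) (sym (w-gap (≮⇒≥ h) l))

  window : ℕ → List Bool
  window i = applyUpTo (λ j → w (i + j)) n

  -- By sliding: the entry w (i + n) that comes in equals the entry w i that goes out.
  ones-window : ∀ i → i ≤ n → ones (window i) ≡ k
  ones-window zero _ with m≤n⇒∃[o]m+o≡n (<⇒≤ k<n)
  ... | m , e = subst (λ n → ones (applyUpTo w n) ≡ k) e
    (ones-block k m w (λ _ → w-start) (λ j l l' → w-gap l (subst (j <_) e l')))
  ones-window (suc i) l = trans (ones-cong (λ j → cong w (sym (+-suc i j))) n) (trans slid (ones-window i (<⇒≤ l)))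
    where
    f = λ j → w (i + j)
    slid : ones (applyUpTo (f ∘ suc) n) ≡ ones (applyUpTo f n)
    slid = +-cancelˡ-≡ (bit (f 0)) _ _ (trans (ones-slide f n)
      (trans (cong (λ b → ones (applyUpTo f n) + bit b) (trans (w-periodic i l) (cong w (sym (+-identityʳ i)))))
        (+-comm _ (bit (f 0)))))

  window-isWord : ∀ i → i ≤ n → IsWord n k (window i)
  window-isWord i l = length-applyUpTo _ n , ones-window i l

  -- Of the window starting at v and the window ending at v, one avoids u.
  window-separates : ∀ {u v} → u < n → v < n → u ≢ v → ∃ λ i → 1 ≤ i × i ≤ n × w (i + v) ≡ true × w (i + u) ≡ false
  window-separates {u} {v} u<n v<n u≢v = compare (<-cmp u v)
    where
    open +-*-Solver
    -- The shift e makes v the first element of the window, and the shift e + k' makes it the last.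
    e : ℕ
    e = n ∸ v
    e+v : e + v ≡ n
    e+v = m∸n+n≡m (<⇒≤ v<n)
    1≤e : 1 ≤ e
    1≤e = m<n⇒0<n∸m v<n
    -- This is why the windows that start and end at v have only v in common.
    2k'<n : k' + k' < n
    2k'<n = ≤-trans (s≤s (+-monoʳ-≤ k' (n≤1+n k'))) 2k≤n
    starts : w (e + v) ≡ true
    starts = trans (cong w e+v) (w-wrap ≤-refl (m<m+n n (s≤s z≤n)))
    ends : w (e + k' + v) ≡ true
    ends = trans (cong w (trans (solve 3 (λ e k v → e :+ k :+ v := (e :+ v) :+ k) refl e k' v) (cong (_+ k') e+v)))
      (w-wrap (m≤m+n n k') (+-monoʳ-< n ≤-refl))
    late : k' ≤ v → e + k' ≤ n
    late l = ≤-trans (+-monoʳ-≤ e l) (≤-reflexive e+v)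
    after : ∀ {d} → v + suc d ≡ u → ∃ λ i → 1 ≤ i × i ≤ n × w (i + v) ≡ true × w (i + u) ≡ false
    after {d} refl with k ≤? suc d | k' ≤? v
    ... | yes h | _ = e , 1≤e , m∸n≤m n v , starts ,
      w-end (≤-trans (+-mono-≤ (≤-reflexive (sym e+v)) h) (≤-reflexive (+-assoc e v (suc d))))
    ... | no h | yes h' = e + k' , ≤-trans 1≤e (m≤m+n e k') , late h' , ends ,
      w-end (≤-trans (+-mono-≤ (≤-reflexive (sym e+v)) (s≤s (m≤m+n k' d)))
        (≤-reflexive (solve 4 (λ e v k d → (e :+ v) :+ (con 1 :+ (k :+ d)) := (e :+ k) :+ (v :+ (con 1 :+ d))) refl e v k' d)))
    ... | no h | no h' with m≤n⇒∃[o]m+o≡n (≰⇒> h')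
    -- Here v < k', so e + k' exceeds n and is reduced by n to k' - v = 1 + c.
    ...   | c , refl = suc c , s≤s z≤n ,
      ≤-trans (≤-trans (m≤n+m (suc c) v) (≤-reflexive (+-suc v c))) (≤-trans (m≤m+n k' k') (<⇒≤ 2k'<n)) ,
      trans (cong w (trans (+-comm (suc c) v) (+-suc v c))) (w-start ≤-refl) ,
      w-gap (≤-trans (s≤s (m≤m+n k' d)) (≤-reflexive eq))
        (≤-<-trans (≤-reflexive (trans (sym eq) (sym (+-suc k' d)))) (≤-<-trans (+-monoʳ-≤ k' (≤-pred (≰⇒> h))) 2k'<n))
      where
      eq : suc (suc (v + c) + d) ≡ suc c + (v + suc d)
      eq = solve 3 (λ v c d → con 1 :+ (con 1 :+ (v :+ c) :+ d) := con 1 :+ c :+ (v :+ (con 1 :+ d))) refl v c d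
    before : ∀ {d} → u + suc d ≡ v → ∃ λ i → 1 ≤ i × i ≤ n × w (i + v) ≡ true × w (i + u) ≡ false
    before {d} eq with k ≤? e + u
    ... | yes h = e , 1≤e , m∸n≤m n v , starts ,
      w-gap h (≤-trans (+-monoʳ-< e (≤-trans (m<m+n u (s≤s z≤n)) (≤-reflexive eq))) (≤-reflexive e+v))
    ... | no h = e + k' , ≤-trans 1≤e (m≤m+n e k') , late k'≤v , ends ,
      w-gap (≤-trans (+-monoˡ-≤ k' 1≤e) (m≤m+n (e + k') u))
        (≤-<-trans (≤-reflexive (solve 3 (λ e k u → e :+ k :+ u := (e :+ u) :+ k) refl e k' u))
          (≤-<-trans (+-monoˡ-≤ k' e+u≤k') 2k'<n))
      where
      e+u≤k' : e + u ≤ k'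
      e+u≤k' = ≤-pred (≰⇒> h)
      k'≤v : k' ≤ v
      k'≤v = +-cancelˡ-≤ k' k' v (≤-trans (<⇒≤ 2k'<n) (≤-trans (≤-reflexive (trans (sym e+v) (trans (cong (e +_) (sym eq)) (sym (+-assoc e u (suc d))))))
        (+-mono-≤ e+u≤k' (≤-trans (m≤n+m (suc d) u) (≤-reflexive eq)))))
    compare : _ → ∃ λ i → 1 ≤ i × i ≤ n × w (i + v) ≡ true × w (i + u) ≡ false
    compare (tri≈ _ h _) = ⊥-elim (u≢v h)
    compare (tri< h _ _) with m≤n⇒∃[o]m+o≡n h
    ... | d , eq = before (trans (+-suc u d) eq)
    compare (tri> _ _ h) with m≤n⇒∃[o]m+o≡n h
    ... | d , eq = after (trans (+-suc v d) eq)

-- The sets A z ⊆ {0, …, p} have size k, differ from P = {0, …, k - 1}, and contain the windows other than P; the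
-- element k stands for the middle vertex x and the others for the vertices y.
module Family (p k' : ℕ) (2k≤n : suc k' + suc k' ≤ suc p) (1≤k' : 1 ≤ k') (R : List (List Bool))
  (distinct : Unique (Window.window (suc p) k' 2k≤n 0 ∷ R))
  (isWord : ∀ {u} → u ∈ R → IsWord (suc p) (suc k') u)
  (windows∈R : ∀ i → 1 ≤ i → i ≤ p → Window.window (suc p) k' 2k≤n i ∈ Window.window (suc p) k' 2k≤n 0 ∷ R) where

  open Window (suc p) k' 2k≤n

  n q : ℕ
  n = suc p
  q = length R

  word : Fin q → List Bool
  word = lookup R

  word-isWord : ∀ z → IsWord n k (word z)
  word-isWord z = isWord (∈-lookup z)

  A : Fin q → ℕ → Bool
  A z = get (word z)

  w-true⇒< : ∀ {j} → j < n → w j ≡ true → j < k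
  w-true⇒< {j} l h = ≰⇒> λ k≤j → true≢false h (w-gap k≤j l)

  w-false⇒≥ : ∀ {j} → w j ≡ false → k ≤ j
  w-false⇒≥ h = ≮⇒≥ λ j<k → true≢false (w-start j<k) h

  get-P : ∀ {j} → j < n → get (window 0) j ≡ w j
  get-P = get-applyUpTo w

  -- The window that contains v and not u gives a z unless it is P itself, and P does this only when
  -- v < k ≤ u.
  separated : ∀ {u v} → u < n → v < n → u ≢ v → ¬ (v < k × k ≤ u) → ∃ λ z → A z u ≡ false × A z v ≡ true
  separated {u} {v} u<n v<n u≢v ¬P with window-separates u<n v<n u≢v
  ... | i , 1≤i , i≤n , hv , hu with i ≤? p
  -- Now i = n, which is the window P again.
  ...   | no i≰p rewrite ≤-antisym i≤n (≰⇒> i≰p) = ⊥-elim (¬P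
      (+-cancelˡ-< n v k (≰⇒> λ l → true≢false hv (w-end l)) ,
       +-cancelˡ-≤ n k u (≮⇒≥ λ l → true≢false (w-wrap (m≤m+n n u) l) hu)))
  ...   | yes i≤p with windows∈R i 1≤i i≤p
  ...     | here e = ⊥-elim (¬P (w-true⇒< v<n (trans (sym (same v<n)) hv) , w-false⇒≥ (trans (sym (same u<n)) hu)))
    where
    same : ∀ {j} → j < n → w (i + j) ≡ w j
    same {j} l = trans (sym (get-applyUpTo (λ j → w (i + j)) l)) (trans (cong (λ u → get u j) e) (get-P l))
  ...     | there m = index m , value-at u<n hu , value-at v<n hv
    where
    value-at : ∀ {j b} → j < n → w (i + j) ≡ b → A (index m) j ≡ b
    value-at {j} l h = trans (cong (λ u → get u j) (sym (lookup-index m))) (trans (get-applyUpTo (λ j → w (i + j)) l) h)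

  high : Fin p → Bool
  high y = does (k ≤? toℕ y)

  -- The increasing enumeration of {0, ..., p} without k; P then consists of exactly the low
  -- positions.
  position : Fin p → ℕ
  position y = if high y then suc (toℕ y) else toℕ y

  position-high : ∀ y → high y ≡ true → position y ≡ suc (toℕ y) × k ≤ toℕ y
  position-high y h = cong (λ b → if b then suc (toℕ y) else toℕ y) h ,
    ≮⇒≥ λ l → true≢false h (dec-false (k ≤? toℕ y) (<⇒≱ l))

  position-low : ∀ y → high y ≡ false → position y ≡ toℕ y × toℕ y < k
  position-low y h = cong (λ b → if b then suc (toℕ y) else toℕ y) h ,
    ≰⇒> λ l → true≢false (dec-true (k ≤? toℕ y) l) h

  position<n : ∀ y → position y < n
  position<n y with high y
  ... | true  = s≤s (toℕ<n y)
  ... | false = m≤n⇒m≤1+n (toℕ<n y)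

  k≤position⇒high : ∀ y → k ≤ position y → high y ≡ true
  k≤position⇒high y l with high y in e
  ... | true  = refl
  ... | false = ⊥-elim (<⇒≱ (proj₂ (position-low y e)) l)

  high⇒k<position : ∀ y → high y ≡ true → k < position y
  high⇒k<position y h with position-high y h
  ... | e , l = subst (k <_) (sym e) (s≤s l)

  position≢k : ∀ y → position y ≢ k
  position≢k y e with high y in h
  ... | true  = <⇒≢ (s≤s (proj₂ (position-high y h))) (sym e)
  ... | false = <⇒≢ (proj₂ (position-low y h)) e

  position-injective : ∀ y y' → position y ≡ position y' → y ≡ y'
  position-injective y y' e with high y in h | high y' in h'
  ... | true  | true  = toℕ-injective (suc-injective e)
  ... | false | false = toℕ-injective e
  ... | true  | false = ⊥-elim (<⇒≱ (proj₂ (position-low y' h')) (≤-trans (m≤n⇒m≤1+n (proj₂ (position-high y h))) (≤-reflexive e)))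
  ... | false | true  = ⊥-elim (<⇒≱ (proj₂ (position-low y h)) (≤-trans (m≤n⇒m≤1+n (proj₂ (position-high y' h'))) (≤-reflexive (sym e))))

  k<p : k < p
  k<p = ≤-pred (≤-trans (≤-trans (≤-reflexive (+-comm 2 k)) (+-monoʳ-≤ k (s≤s 1≤k'))) 2k≤n)

  at-low : ∀ {j} → j < k → ∃ λ y → position y ≡ j × high y ≡ false
  at-low {j} l = y , trans (cong (λ b → if b then suc (toℕ y) else toℕ y) h) e , h
    where
    y : Fin p
    y = fromℕ< (<-trans l k<p)
    e : toℕ y ≡ j
    e = toℕ-fromℕ< (<-trans l k<p)
    h : high y ≡ false
    h = dec-false (k ≤? toℕ y) (<⇒≱ (subst (_< k) (sym e) l))

  at-high : ∀ {j} → k < j → j < n → ∃ λ y → position y ≡ j × high y ≡ true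
  at-high {suc j} (s≤s l) (s≤s l') = y , trans (cong (λ b → if b then suc (toℕ y) else toℕ y) h) (cong suc e) , h
    where
    y : Fin p
    y = fromℕ< l'
    e : toℕ y ≡ j
    e = toℕ-fromℕ< l'
    h : high y ≡ true
    h = dec-true (k ≤? toℕ y) (subst (k ≤_) (sym e) l)

  at-position : ∀ {j} → j < n → j ≢ k → ∃ λ y → position y ≡ j
  at-position {j} l j≢k with <-cmp j k
  ... | tri< j<k _ _ = let y , e , _ = at-low j<k in y , e
  ... | tri≈ _ e _   = ⊥-elim (j≢k e)
  ... | tri> _ _ k<j = let y , e , _ = at-high k<j l in y , e

  c : Fin q → Bool
  c z = A z k

  B : Fin q → Fin p → Bool
  B z y = A z (position y)

  hit : ∀ y → ∃ λ z → B z y ≡ true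
  -- Any index below k other than that of y can serve as the one to be avoided; 0 or 1 will do, as k
  -- ≥ 2.
  hit y with position y ≟ℕ 0
  ... | yes e with separated {1} {position y} (s≤s (≤-trans (s≤s z≤n) k<p)) (position<n y) (λ e' → 1+n≢0 (trans e' e)) (λ (_ , l) → <⇒≱ (s≤s 1≤k') l)
  ...   | z , _ , h = z , h
  hit y | no n≢0 with separated {0} {position y} (s≤s z≤n) (position<n y) (λ e → n≢0 (sym e)) (λ { (_ , ()) })
  ...   | z , _ , h = z , h

  hit-high : ∀ y → high y ≡ true → ∃ λ z → c z ≡ false × B z y ≡ true
  hit-high y h = separated k<n (position<n y) (λ e → position≢k y (sym e)) λ (l , _) → <⇒≯ (high⇒k<position y h) l

  miss : ∀ y → ∃ λ z → c z ≡ true × B z y ≡ false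
  miss y with separated (position<n y) k<n (position≢k y) (λ (l , _) → <-irrefl refl l)
  ... | z , h , h' = z , h' , h

  -- Only for y high and y' low could P be the separating window; then the path goes through x₁
  -- instead.
  separate : ∀ y y' → y ≢ y' → (high y ≡ true × high y' ≡ false) ⊎ ∃ λ z → B z y ≡ false × B z y' ≡ true
  separate y y' n = go (high y) (high y') refl refl
    where
    elsewhere : ¬ (position y' < k × k ≤ position y) → ∃ λ z → B z y ≡ false × B z y' ≡ true
    elsewhere = separated (position<n y) (position<n y') (n ∘ position-injective y y')
    go : ∀ b b' → high y ≡ b → high y' ≡ b' → (high y ≡ true × high y' ≡ false) ⊎ ∃ λ z → B z y ≡ false × B z y' ≡ true
    go true  false h h' = inj₁ (h , h')
    go true  true  h h' = inj₂ (elsewhere λ (l , _) → <⇒≯ (high⇒k<position y' h') l)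
    go false _     h h' = inj₂ (elsewhere λ (_ , l) → true≢false (k≤position⇒high y l) h)

  differ : ∀ u v → length u ≡ n → length v ≡ n → ones v ≤ ones u → u ≢ v → ∃ λ j → j < n × get u j ≡ true × get v j ≡ false
  differ u v lu lv l u≢v with separate-words u v (trans lu (sym lv)) l
  ... | inj₁ (j , j< , h) = j , subst (j <_) lu j< , h
  ... | inj₂ e = ⊥-elim (u≢v e)

  incomparable : ∀ z z' → z ≢ z' → (c z ≡ true × c z' ≡ false) ⊎ ∃ λ y → B z y ≡ true × B z' y ≡ false
  incomparable z z' n with word-isWord z | word-isWord z'
  ... | l , o | l' , o'
    with differ (word z) (word z') l l' (≤-reflexive (trans o' (sym o))) (n ∘ lookup-injective (tail distinct) z z')
    where
    tail : ∀ {u : List Bool} {L} → Unique (u ∷ L) → Unique L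
    tail (_ ∷ u) = u
  ...   | j , j<n , h , h' with j ≟ℕ k
  ...     | yes refl = inj₁ (h , h')
  ...     | no j≢k with at-position j<n j≢k
  ...       | y , refl = inj₂ (y , h , h')

  P∉R : ∀ z → window 0 ≢ word z
  P∉R z e = head distinct
    where
    head : Unique (window 0 ∷ R) → ⊥
    head (a ∷ _) = All.lookup a (∈-lookup z) e

  -- The set of z has the size of P and differs from it, so it has an element outside P, and this is
  -- not k because c z is `false`.
  contains-high : ∀ z → c z ≡ false → ∃ λ y → high y ≡ true × B z y ≡ true
  contains-high z e with word-isWord z | window-isWord 0 z≤n
  ... | l , o | l' , o' with differ (word z) (window 0) l l' (≤-reflexive (trans o' (sym o))) (P∉R z ∘ sym)
  ...   | j , j<n , h , h' with at-high (≤∧≢⇒< (w-false⇒≥ (trans (sym (get-P j<n)) h')) λ { refl → true≢false h e }) j<n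
  ...     | y , refl , hy = y , hy , h

  omits-low : ∀ z → c z ≡ true → ∃ λ y → high y ≡ false × B z y ≡ false
  omits-low z e with word-isWord z | window-isWord 0 z≤n
  ... | l , o | l' , o' with differ (window 0) (word z) l' l (≤-reflexive (trans o (sym o'))) (P∉R z)
  ...   | j , j<n , h , h' with at-low (w-true⇒< j<n (trans (sym (get-P j<n)) h))
  ...     | y , refl , hy = y , hy , h'

  ≡ᵇ-refl : ∀ j → (j ≡ᵇ j) ≡ true
  ≡ᵇ-refl zero    = refl
  ≡ᵇ-refl (suc j) = ≡ᵇ-refl j

  -- A set of size k ≥ 2 is not contained in {k}.
  contains : ∀ z → ∃ λ y → B z y ≡ true
  contains z with word-isWord z
  ... | l , o with differ (word z) (applyUpTo (_≡ᵇ k) n) l (length-applyUpTo (_≡ᵇ k) n) (<⇒≤ lighter) (λ e → <⇒≢ lighter (sym (cong ones e)))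
    where
    lighter : ones (applyUpTo (_≡ᵇ k) n) < ones (word z)
    lighter = ≤-<-trans (ones-point n k) (subst (1 <_) (sym o) (s≤s 1≤k'))
  ...   | j , j<n , h , h' with at-position j<n (λ { refl → true≢false (≡ᵇ-refl k) (trans (sym (get-applyUpTo (_≡ᵇ k) j<n)) h') })
  ...     | y , refl = y , h

  -- The complement of {k} has at least p > k elements, too many to lie inside a set of size k.
  omits : ∀ z → ∃ λ y → B z y ≡ false
  omits z with word-isWord z
  ... | l , o with differ (applyUpTo (not ∘ (_≡ᵇ k)) n) (word z) (length-applyUpTo (not ∘ (_≡ᵇ k)) n) l (<⇒≤ lighter) (λ e → <⇒≢ lighter (sym (cong ones e)))
    where
    lighter : ones (word z) < ones (applyUpTo (not ∘ (_≡ᵇ k)) n)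
    lighter = subst (_< ones (applyUpTo (not ∘ (_≡ᵇ k)) n)) (sym o) (<-≤-trans k<p (+-cancelˡ-≤ 1 _ _
      (≤-trans (≤-reflexive (sym (ones-complement (_≡ᵇ k) n))) (+-monoˡ-≤ _ (ones-point n k)))))
  ...   | j , j<n , h , h' with at-position j<n (λ { refl → true≢false (≡ᵇ-refl k) (not-true (trans (sym (get-applyUpTo (not ∘ (_≡ᵇ k)) j<n)) h)) })
  ...     | y , refl = y , h'

  family-diameter-2 : OrientedDiam (K3 3 p q) 2
  family-diameter-2 = Diameter2.oriented-diameter-2 high c B
    (let y , _ , h = at-high k<p ≤-refl in y , h) (let y , _ , h = at-low {0} (s≤s z≤n) in y , h)
    hit hit-high miss separate contains contains-high omits omits-low incomparable (≤-trans (s≤s z≤n) k<p)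

-- Choice of a family of size q, and the two cases of the theorem

oriented-diameter-2 : ∀ {p q} → 5 ≤ p → p ≤ q → q < s (suc p) → OrientedDiam (K3 3 p q) 2
oriented-diameter-2 {p} {q} 5≤p p≤q q<s = build (⌊ n /2⌋) refl
  where
  n : ℕ
  n = suc p
  2≤half : 2 ≤ ⌊ n /2⌋
  2≤half = ≤-trans (s≤s (s≤s z≤n)) (⌊n/2⌋-mono (s≤s 5≤p))
  2half≤n : ⌊ n /2⌋ + ⌊ n /2⌋ ≤ n
  2half≤n = ≤-trans (+-monoʳ-≤ ⌊ n /2⌋ (⌊n/2⌋≤⌈n/2⌉ n)) (≤-reflexive (⌊n/2⌋+⌈n/2⌉≡n n))
  build : ∀ k → k ≡ ⌊ n /2⌋ → OrientedDiam (K3 3 p q) 2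
  build zero e = ⊥-elim (<⇒≱ 2≤half (≤-trans (≤-reflexive (sym e)) z≤n))
  build (suc k') e = conclude
    where
    2k≤n : suc k' + suc k' ≤ n
    2k≤n = subst (λ k → k + k ≤ n) (sym e) 2half≤n
    1≤k' : 1 ≤ k'
    1≤k' = ≤-pred (subst (2 ≤_) (sym e) 2≤half)
    open Window n k' 2k≤n
    size : length (words n k) ≡ s n
    size = trans (length-words n k) (trans (cong (n C_) (trans e (sym (n/2≡⌊n/2⌋ n)))) (s≡central n))
    conclude : OrientedDiam (K3 3 p q) 2
    conclude with insert-all (window 0) (applyUpTo (window ∘ suc) p)
    ... | R , uR , sub , sup , l
      with extend (window 0) R (words-unique n k) uR q
             -- At most p windows other than P have to be included, and p ≤ q makes room for them.
             (≤-trans l (≤-trans (≤-reflexive (length-applyUpTo (window ∘ suc) p)) p≤q)) (subst (q <_) (sym size) q<s)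
    ...   | R' , uR' , sub' , sup' , refl = Family.family-diameter-2 p k' 2k≤n 1≤k' R' uR' sound windows
      where
      sound : ∀ {u} → u ∈ R' → IsWord n k u
      sound m with sup' m
      ... | inj₂ m' = words-sound n k m'
      ... | inj₁ m' with ∈-applyUpTo⁻ (window ∘ suc) (sup m')
      ...   | i , i<p , refl = window-isWord (suc i) (s≤s (<⇒≤ i<p))
      widen : ∀ {u} → u ∈ window 0 ∷ R → u ∈ window 0 ∷ R'
      widen (here e)  = here e
      widen (there m) = there (sub' m)
      windows : ∀ i → 1 ≤ i → i ≤ p → window i ∈ window 0 ∷ R'
      windows (suc i) _ l = widen (sub (∈-applyUpTo⁺ (window ∘ suc) l))

theorem1p2 : (p q : ℕ) → 5 ≤ p → p ≤ q →
    (q < (p + 1) C ((p + 1) / 2) → OrientedDiam (K3 3 p q) 2) ×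
    ((p + 1) C ((p + 1) / 2) ≤ q → OrientedDiam (K3 3 p q) 3)
theorem1p2 p q 5≤p p≤q =
  (λ h → oriented-diameter-2 5≤p p≤q (subst (q <_) central h)) ,
  (λ h → oriented-diameter-3 5≤p p≤q (subst (_≤ q) central h))
  where
  central : (p + 1) C ((p + 1) / 2) ≡ s (suc p)
  central = trans (cong (λ n → n C (n / 2)) (+-comm p 1)) (s≡central (suc p))
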